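{- Let $n\ge 2$ and let $\alpha_1\ge\alpha_2\ge\dots\ge\alpha_n>0$ be ordinals, and $X=\omega^{\alpha_1}\times\dots\times\omega^{\alpha_n}$. Then $\mathbf{w}(X)=\omega^{\eta}$ with $\eta=\alpha_1\oplus\bigl((\alpha_2\oplus\dots\oplus\alpha_n)-1\bigr)$. Explicitly: if all $\alpha_i$ are finite then $\eta=\alpha_1+\dots+\alpha_n-1$; if $\alpha_1$ is infinite and $\alpha_2,\dots,\alpha_n$ are finite then $\eta=\alpha_1+(\alpha_2+\dots+\alpha_n-1)$; if at least two of the $\alpha_i$ are infinite then $\eta=\alpha_1\oplus\dots\oplus\alpha_n$.
   Context: Ordinals are well-orders; $X$ has the componentwise order. The width $\mathbf{w}(A)$ of a wqo $A$ is the rank of the forest of nonempty finite sequences of pairwise incomparable elements of $A$ ordered by initial segment ($\mathbf{w}(A)=\sup_s(r(s)+1)$, $r(s)=\sup\{r(t)+1:t$ child of $s\}$). $\oplus$ is the natural (Hessenberg) sum. For ordinals $\beta\le\gamma$, $\gamma-\beta$ denotes the unique ordinal $\delta$ with $\beta+\delta=\gamma$ (left subtraction); in particular $\gamma-1=\gamma$ for infinite $\gamma$ and $\gamma-1$ is the predecessor for finite $\gamma\ge 1$. -}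

module Defs where

open import Axiom.ExcludedMiddle using (ExcludedMiddle)
open import Data.Empty.Polymorphic using (⊥)
open import Data.Fin.Base using (Fin)
open import Data.List.NonEmpty.Base using (List⁺; toList; _∷⁺_)
open import Data.List.Relation.Unary.AllPairs using (AllPairs)
open import Data.Maybe.Base using (Maybe; just; nothing)
open import Data.Nat.Base using (ℕ; zero; suc)
open import Data.Product.Base using (Σ; ∃; _×_; _,_; proj₁; proj₂)
open import Data.Sum.Base using (_⊎_; inj₁; inj₂; [_,_]′)
open import Data.Unit.Polymorphic.Base using (⊤)
open import Data.Vec.Functional using (Vector; foldr)
open import Induction.WellFounded using (WellFounded; Acc; acc)
open import Level using (Level; _⊔_) renaming (suc to lsuc)
open import Relation.Binary.Bundles using (Preorder)
import Relation.Binary.Construct.On as On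
open import Relation.Binary.PropositionalEquality.Core using (_≡_)
open import Relation.Nullary.Decidable.Core using (yes; no)
open import Relation.Nullary.Negation.Core using (¬_; contradiction)

private
  variable
    a b c ℓ ℓ₁ ℓ₂ : Level

infix  4 _≤_ _<_ _≈_
infixl 6 _+_ _⊕_ _∸_
infixl 7 _·_
infix  8 ω^_

-- Ordinals as well-founded trees: sup⁺ I f is the least ordinal strictly
-- above every f i.  Different trees may denote the same ordinal, so equality
-- of ordinals is _≈_.  The relations compare ordinals of different universes
-- because the rank of a large forest is a large tree.

data Ord (ℓ : Level) : Set (lsuc ℓ) where
  sup⁺ : (I : Set ℓ) → (I → Ord ℓ) → Ord ℓ

mutual
  _≤_ : Ord a → Ord b → Set (a ⊔ b)
  sup⁺ I f ≤ y = ∀ i → f i < y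

  _<_ : Ord a → Ord b → Set (a ⊔ b)
  x < sup⁺ J g = Σ J λ j → x ≤ g j

_≈_ : Ord a → Ord b → Set (a ⊔ b)
x ≈ y = x ≤ y × y ≤ x

𝟘 : Ord ℓ
𝟘 = sup⁺ ⊥ λ ()

sucᵒ : Ord ℓ → Ord ℓ
sucᵒ x = sup⁺ ⊤ λ _ → x

fromℕ : ℕ → Ord ℓ
fromℕ zero    = 𝟘
fromℕ (suc k) = sucᵒ (fromℕ k)

𝟙 : Ord ℓ
𝟙 = fromℕ 1

Finite : Ord ℓ → Set ℓ
Finite {ℓ} x = ∃ λ k → x ≈ fromℕ {ℓ} k

-- x + y is the least ordinal above all x' < x and all x + y' with y' < y.

_+_ : Ord ℓ → Ord ℓ → Ord ℓ
x@(sup⁺ I f) + sup⁺ J g = sup⁺ (I ⊎ J) [ f , (λ j → x + g j) ]′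

-- The recursive form of the Hessenberg sum: x ⊕ y is the least ordinal above
-- all x' ⊕ y with x' < x and all x ⊕ y' with y' < y.

_⊕_ : Ord ℓ → Ord ℓ → Ord ℓ
x@(sup⁺ I f) ⊕ y@(sup⁺ J g) =
  sup⁺ (I ⊎ J) [ (λ i → f i ⊕ y) , (λ j → x ⊕ g j) ]′

∑ ⨁ : ∀ {n} → Vector (Ord ℓ) n → Ord ℓ
∑ = foldr _+_ 𝟘
⨁ = foldr _⊕_ 𝟘

-- Left subtraction: γ ∸ β is the least ordinal above all c ∸ β with
-- β ≤ c < γ (hence 𝟘 when γ ≤ β).  It is characterised by +-∸ and
-- +-cancelˡ-≈ below.

_∸_ : Ord ℓ → Ord ℓ → Ord ℓ
sup⁺ K h ∸ β = sup⁺ (Σ K λ k → β ≤ h k) λ (k , _) → h k ∸ β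

_·_ : Ord ℓ → ℕ → Ord ℓ
x · zero  = 𝟘
x · suc k = x · k + x

-- For every x, ω ^ x = sup ({1} ∪ {(ω ^ x') · k ∣ x' < x, k < ω}); the three
-- usual clauses (zero, successor, limit) are instances.

ω^_ : Ord ℓ → Ord ℓ
ω^ sup⁺ I f = sup⁺ (Maybe (I × ℕ)) λ where
  nothing        → 𝟘
  (just (i , k)) → (ω^ f i) · k

≤-refl : (x : Ord a) → x ≤ x
≤-refl (sup⁺ I f) i = i , ≤-refl (f i)

≤-trans : (x : Ord a) (y : Ord b) (z : Ord c) → x ≤ y → y ≤ z → x ≤ z
≤-trans (sup⁺ I f) (sup⁺ J g) (sup⁺ K h) p q i with p i
... | j , r with q j
...   | k , s = k , ≤-trans (f i) (g j) (h k) r s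

≤-<-trans : (x : Ord a) (y : Ord b) (z : Ord c) → x ≤ y → y < z → x < z
≤-<-trans x y (sup⁺ K h) p (k , q) = k , ≤-trans x y (h k) p q

<-irrefl : (x : Ord a) → ¬ (x < x)
<-irrefl (sup⁺ I f) (i , p) =
  <-irrefl (f i) (≤-<-trans (f i) (f i) (f i) (≤-refl (f i)) (p i))

≤-<-total : ExcludedMiddle ℓ → (x y : Ord ℓ) → x ≤ y ⊎ y < x
≤-<-total em (sup⁺ I f) (sup⁺ J g) with em {Σ I λ i → ∀ j → g j < f i}
... | yes p = inj₂ p
... | no ¬p = inj₁ below-y
  where
  below-y : ∀ i → f i < sup⁺ J g
  below-y i with em {Σ J λ j → f i ≤ g j}
  ... | yes q = q
  ... | no ¬q = contradiction (i , above) ¬p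
    where
    above : ∀ j → g j < f i
    above j with ≤-<-total em (f i) (g j)
    ... | inj₁ r = contradiction (j , r) ¬q
    ... | inj₂ r = r

≤-+ʳ : (x y : Ord ℓ) → x ≤ x + y
≤-+ʳ (sup⁺ I f) (sup⁺ J g) i = inj₁ i , ≤-refl (f i)

+-∸ : ExcludedMiddle ℓ → (β γ : Ord ℓ) → β ≤ γ → β + (γ ∸ β) ≈ γ
+-∸ em β@(sup⁺ I f) γ@(sup⁺ K h) β≤γ = below-γ , above-γ
  where
  below-γ : β + (γ ∸ β) ≤ γ
  below-γ (inj₁ i)       = β≤γ i
  below-γ (inj₂ (k , p)) = k , proj₁ (+-∸ em β (h k) p)

  above-γ : γ ≤ β + (γ ∸ β)
  above-γ k with ≤-<-total em β (h k)
  ... | inj₁ p       = inj₂ (k , p) , proj₂ (+-∸ em β (h k) p)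
  ... | inj₂ (i , p) = inj₁ i , p

+-cancelˡ-≤ : (β δ ε : Ord ℓ) → β + δ ≤ β + ε → δ ≤ ε
+-cancelˡ-≤ β@(sup⁺ I f) (sup⁺ J g) (sup⁺ K h) p j with p (inj₂ j)
... | inj₁ i , q = contradiction (i , ≤-trans β (β + g j) (f i) (≤-+ʳ β (g j)) q) (<-irrefl β)
... | inj₂ k , q = k , +-cancelˡ-≤ β (g j) (h k) q

+-cancelˡ-≈ : (β δ ε : Ord ℓ) → β + δ ≈ β + ε → δ ≈ ε
+-cancelˡ-≈ β δ ε (p , q) = +-cancelˡ-≤ β δ ε p , +-cancelˡ-≤ β ε δ q

≤-preorder : ∀ ℓ → Preorder (lsuc ℓ) ℓ ℓ
≤-preorder ℓ = record
  { Carrier    = Ord ℓ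
  ; _≈_        = _≈_
  ; _≲_        = _≤_
  ; isPreorder = record
    { isEquivalence = record
      { refl  = λ {x} → ≤-refl x , ≤-refl x
      ; sym   = λ (p , q) → q , p
      ; trans = λ {x} {y} {z} (p , p′) (q , q′) →
                  ≤-trans x y z p q , ≤-trans z y x q′ p′
      }
    ; reflexive = proj₁
    ; trans     = λ {x} {y} {z} → ≤-trans x y z
    }
  }

-- The ordinal α as an ordered set: the ordinals below α (up to _≈_, and the
-- elements of an antichain are never ≈-equal, being incomparable).

↓ : Ord ℓ → Preorder (lsuc ℓ) ℓ ℓ
↓ {ℓ} α = On.preorder (≤-preorder ℓ) (proj₁ {B = λ x → x < α})

Π-preorder : ∀ {n} → Vector (Preorder c ℓ₁ ℓ₂) n → Preorder c ℓ₁ ℓ₂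
Π-preorder {n = n} P = record
  { Carrier    = (i : Fin n) → P.Carrier i
  ; _≈_        = λ x y → ∀ i → P._≈_ i (x i) (y i)
  ; _≲_        = λ x y → ∀ i → P._≲_ i (x i) (y i)
  ; isPreorder = record
    { isEquivalence = record
      { refl  = λ i → P.Eq.refl i
      ; sym   = λ p i → P.Eq.sym i (p i)
      ; trans = λ p q i → P.Eq.trans i (p i) (q i)
      }
    ; reflexive = λ p i → P.reflexive i (p i)
    ; trans     = λ p q i → P.trans i (p i) (q i)
    }
  }
  where module P (i : Fin n) = Preorder (P i)

module _ (A : Preorder c ℓ₁ ℓ₂) where
  open Preorder A using (Carrier; _≲_)

  _∥_ : Carrier → Carrier → Set ℓ₂
  x ∥ y = ¬ (x ≲ y) × ¬ (y ≲ x)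

  -- Sequences are stored last element first, so extending a sequence at its
  -- end is _∷⁺_.

  record Antichain : Set (c ⊔ ℓ₂) where
    field
      sequence     : List⁺ Carrier
      incomparable : AllPairs _∥_ (toList sequence)

  open Antichain

  _IsChildOf_ : Antichain → Antichain → Set c
  t IsChildOf s = ∃ λ x → sequence t ≡ x ∷⁺ sequence s

  rank : (s : Antichain) → Acc _IsChildOf_ s → Ord (c ⊔ ℓ₂)
  rank s (acc rs) = sup⁺ (∃ λ t → t IsChildOf s) λ (t , p) → rank t (rs p)

  width : WellFounded _IsChildOf_ → Ord (c ⊔ ℓ₂)
  width wf = sup⁺ Antichain λ s → rank s (wf s)

  -- The width is defined only when the forest is well-founded, so HasWidth
  -- asserts this too.

  HasWidth : Ord ℓ → Set (c ⊔ ℓ₂ ⊔ ℓ)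
  HasWidth γ = Σ (WellFounded _IsChildOf_) λ wf → width wf ≈ γ

{-# OPTIONS --safe #-}

-- Call a reduction of α = (α₁, …, αₙ) the lowering of one coordinate αₚ to some a < αₚ,
-- the others being kept.  The exponent of the width is computed by recursion along
-- reductions.
--
-- Upper bound: what is incomparable to x lies in ⋃ₚ {y ∣ yₚ < xₚ}, and as xₚ ≤ ω^a · k for
-- some a < αₚ, each of these sets is covered by k slices isomorphic to the product for the
-- reduction (α with a at p).  The widths of the slices add up naturally, and ω^γ is closed
-- under ⊕, so the width is at most ω^γ as soon as every reduction has width at most ω^γ′ for
-- some γ′ < γ.  The recursion starts from the products with at most one positive αᵢ, which
-- are chains.
--
-- Lower bound: if αₚ is lowered to a, and some other α_q is positive, then the box with pth
-- side ω^a · k has at least k times the width of the one with side ω^a.  Play an antichain in the top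
-- slice; its finitely many elements are bounded in coordinate q, and everything above that
-- bound in coordinate q, in the lower slices, is a copy of the whole of those slices
-- incomparable to the elements played.
--
-- Both recursions are solved by the exponent α₁ ⊕ ((α₂ ⊕ … ⊕ αₙ) ∸ 1), which for the lower
-- bound takes the form 1 + ((α₁ ∸ 1) ⊕ ((α₂ ⊕ … ⊕ αₙ) ∸ 1)).

module Submission where

open import Defs
open import Axiom.ExcludedMiddle using (ExcludedMiddle)
open import Data.Fin.Base as Fin using (Fin; zero; suc)
open import Data.Fin.Properties using (_≟_; ¬∀⟶∃¬)
open import Data.List.Base using (List; []; _∷_)
open import Data.List.NonEmpty.Base using (module List⁺; toList; _∷_)
open import Data.List.Relation.Unary.All using (All; []; _∷_)
open import Data.List.Relation.Unary.AllPairs using (AllPairs; []; _∷_)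
open import Data.Maybe.Base using (just; nothing)
open import Data.Nat.Base as ℕ using (ℕ; zero; suc; z≤n; s≤s)
import Data.Nat.Properties as ℕ
open import Data.Product.Base using (Σ; ∃; ∃₂; _×_; _,_; proj₁; proj₂)
open import Data.Sum.Base as Sum using (_⊎_; inj₁; inj₂)
open import Data.Unit.Polymorphic.Base using (⊤; tt)
open import Data.Vec.Functional using (Vector; head; tail; updateAt)
open import Data.Vec.Functional.Properties using (updateAt-updates; updateAt-minimal; map-updateAt)
open import Function.Base using (_∘_; const; id)
open import Induction.WellFounded using (WellFounded; Acc; acc)
open import Level using (Level; Lift; lift; lower; _⊔_) renaming (suc to lsuc)
open import Relation.Binary.Bundles using (Preorder)
open import Relation.Binary.PropositionalEquality.Core using (_≡_; _≢_; refl; sym; cong; subst)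
import Relation.Binary.Reasoning.Base.Triple as Triple
open import Relation.Nullary.Decidable using (yes; no; map′)
open import Relation.Nullary.Negation.Core using (¬_; contradiction)
open import Relation.Unary using (Pred; _⊆_)

private
  variable
    a b c d e p ℓ ℓ₁ ℓ₂ : Level
    n : ℕ

-- Ordinal arithmetic

<-≤-trans : (x : Ord a) (y : Ord b) (z : Ord c) → x < y → y ≤ z → x < z
<-≤-trans x (sup⁺ J g) (sup⁺ K h) (j , p) q with q j
... | k , r = k , ≤-trans x (g j) (h k) p r

<⇒≤ : (x : Ord a) (y : Ord b) → x < y → x ≤ y
<⇒≤ (sup⁺ I f) (sup⁺ J g) (j , p) i = j , <⇒≤ (f i) (g j) (p i)

≤⇒<sucᵒ : {x : Ord a} {y : Ord b} → x ≤ y → x < sucᵒ y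
≤⇒<sucᵒ p = tt , p

<⇒sucᵒ≤ : {x : Ord a} {y : Ord b} → x < y → sucᵒ x ≤ y
<⇒sucᵒ≤ p _ = p

𝟘≤ : (x : Ord a) → 𝟘 {b} ≤ x
𝟘≤ x ()

≮𝟘 : {x : Ord a} → ¬ (x < 𝟘 {b})
≮𝟘 (() , _)

module ≤-Reasoning {ℓ} = Triple {_≈_ = _≈_ {ℓ}} {_≤_ = _≤_} {_<_ = _<_}
  (Preorder.isPreorder (≤-preorder ℓ))
  (λ {x} {y} p q → <-irrefl x (<-≤-trans x y x p (<⇒≤ y x q)))
  (λ {x} {y} {z} p q → <-≤-trans x y z p (<⇒≤ y z q))
  ((λ {x} {y} {z} p q → <-≤-trans x y z q (proj₁ p)) ,
   (λ {x} {y} {z} p q → ≤-<-trans z y x (proj₂ p) q))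
  (λ {x} {y} → <⇒≤ {ℓ} {ℓ} x y)
  (λ {x} {y} {z} → <-≤-trans x y z)
  (λ {x} {y} {z} → ≤-<-trans x y z)

≈-sym : {x : Ord a} {y : Ord b} → x ≈ y → y ≈ x
≈-sym (p , q) = q , p

+-mono-≤ : (x x′ y y′ : Ord ℓ) → x ≤ x′ → y ≤ y′ → x + y ≤ x′ + y′
+-mono-≤ (sup⁺ _ _) (sup⁺ _ _) (sup⁺ _ _) (sup⁺ _ _) p q (inj₁ i) with p i
... | i′ , r = inj₁ i′ , r
+-mono-≤ x@(sup⁺ _ _) x′@(sup⁺ _ _) (sup⁺ J g) (sup⁺ K h) p q (inj₂ j) with q j
... | k , r = inj₂ k , +-mono-≤ x x′ (g j) (h k) p r

+-monoʳ-< : (x y z : Ord ℓ) → y < z → x + y < x + z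
+-monoʳ-< x@(sup⁺ _ _) y (sup⁺ K h) (k , p) =
  inj₂ k , +-mono-≤ x x y (h k) (≤-refl x) p

+-cong : {x x′ y y′ : Ord ℓ} → x ≈ x′ → y ≈ y′ → x + y ≈ x′ + y′
+-cong (p , p′) (q , q′) = +-mono-≤ _ _ _ _ p q , +-mono-≤ _ _ _ _ p′ q′

⊕-mono-≤ : (x x′ y y′ : Ord ℓ) → x ≤ x′ → y ≤ y′ → x ⊕ y ≤ x′ ⊕ y′
⊕-mono-≤ (sup⁺ I f) (sup⁺ I′ f′) y@(sup⁺ J g) y′@(sup⁺ J′ g′) p q (inj₁ i) =
  inj₁ (proj₁ (p i)) , ⊕-mono-≤ (f i) (f′ (proj₁ (p i))) y y′ (proj₂ (p i)) q
⊕-mono-≤ x@(sup⁺ I f) x′@(sup⁺ I′ f′) (sup⁺ J g) (sup⁺ J′ g′) p q (inj₂ j) =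
  inj₂ (proj₁ (q j)) , ⊕-mono-≤ x x′ (g j) (g′ (proj₁ (q j))) p (proj₂ (q j))

⊕-cong : {x x′ y y′ : Ord ℓ} → x ≈ x′ → y ≈ y′ → x ⊕ y ≈ x′ ⊕ y′
⊕-cong (p , p′) (q , q′) = ⊕-mono-≤ _ _ _ _ p q , ⊕-mono-≤ _ _ _ _ p′ q′

⊕-monoˡ-< : (x x′ y : Ord ℓ) → x < x′ → x ⊕ y < x′ ⊕ y
⊕-monoˡ-< x (sup⁺ I f) y@(sup⁺ _ _) (i , p) =
  inj₁ i , ⊕-mono-≤ x (f i) y y p (≤-refl y)

⊕-monoʳ-< : (x y y′ : Ord ℓ) → y < y′ → x ⊕ y < x ⊕ y′
⊕-monoʳ-< x@(sup⁺ _ _) y (sup⁺ I f) (i , p) =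
  inj₂ i , ⊕-mono-≤ x x y (f i) (≤-refl x) p

y≤x⊕y : (x y : Ord ℓ) → y ≤ x ⊕ y
y≤x⊕y x@(sup⁺ _ _) (sup⁺ J g) j = inj₂ j , y≤x⊕y x (g j)

x≤x⊕y : (x y : Ord ℓ) → x ≤ x ⊕ y
x≤x⊕y (sup⁺ I f) y@(sup⁺ _ _) i = inj₁ i , x≤x⊕y (f i) y

+≤⊕ : (x y : Ord ℓ) → x + y ≤ x ⊕ y
+≤⊕ (sup⁺ I f) y@(sup⁺ J g) (inj₁ i) = inj₁ i , x≤x⊕y (f i) y
+≤⊕ x@(sup⁺ I f) (sup⁺ J g) (inj₂ j) = inj₂ j , +≤⊕ x (g j)

y≤x+y : (x y : Ord ℓ) → y ≤ x + y
y≤x+y x@(sup⁺ _ _) (sup⁺ J g) j = inj₂ j , y≤x+y x (g j)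

𝟘⊕y≤y : (y : Ord ℓ) → 𝟘 ⊕ y ≤ y
𝟘⊕y≤y (sup⁺ J g) (inj₂ j) = j , 𝟘⊕y≤y (g j)

x⊕𝟘≤x : (x : Ord ℓ) → x ⊕ 𝟘 ≤ x
x⊕𝟘≤x (sup⁺ I f) (inj₁ i) = i , x⊕𝟘≤x (f i)

<-+⁻ : (x y : Ord ℓ) {z : Ord ℓ} → z < x + y → z < x ⊎ ∃ λ y′ → y′ < y × z ≤ x + y′
<-+⁻ (sup⁺ I f) (sup⁺ J g) (inj₁ i , p) = inj₁ (i , p)
<-+⁻ (sup⁺ I f) (sup⁺ J g) (inj₂ j , p) = inj₂ (g j , (j , ≤-refl (g j)) , p)

+-cancelˡ-< : (x y z : Ord ℓ) → x + y < x + z → y < z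
+-cancelˡ-< x@(sup⁺ I f) y (sup⁺ K h) (inj₁ i , p) =
  contradiction (i , ≤-trans x (x + y) (f i) (≤-+ʳ x y) p) (<-irrefl x)
+-cancelˡ-< x@(sup⁺ I f) y (sup⁺ K h) (inj₂ k , p) = k , +-cancelˡ-≤ x y (h k) p

<-⊕⁻ : (x y : Ord ℓ) {z : Ord ℓ} → z < x ⊕ y →
       (∃ λ x′ → x′ < x × z ≤ x′ ⊕ y) ⊎ (∃ λ y′ → y′ < y × z ≤ x ⊕ y′)
<-⊕⁻ (sup⁺ I f) (sup⁺ J g) (inj₁ i , p) = inj₁ (f i , (i , ≤-refl (f i)) , p)
<-⊕⁻ (sup⁺ I f) (sup⁺ J g) (inj₂ j , p) = inj₂ (g j , (j , ≤-refl (g j)) , p)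

⊕-≤ : (x y : Ord ℓ) {z : Ord ℓ} →
      (∀ x′ → x′ < x → x′ ⊕ y < z) → (∀ y′ → y′ < y → x ⊕ y′ < z) → x ⊕ y ≤ z
⊕-≤ (sup⁺ I f) (sup⁺ J g) p q (inj₁ i) = p (f i) (i , ≤-refl (f i))
⊕-≤ (sup⁺ I f) (sup⁺ J g) p q (inj₂ j) = q (g j) (j , ≤-refl (g j))

-- Multiples, powers of ω and closure under the natural sum.

·-mono-≤ : (x y : Ord ℓ) {k l : ℕ} → x ≤ y → k ℕ.≤ l → x · k ≤ y · l
·-mono-≤ x y {l = l} p z≤n = 𝟘≤ (y · l)
·-mono-≤ x y p (s≤s q) = +-mono-≤ _ _ x y (·-mono-≤ x y p q) p

-- For nonzero `θ` these are the additively indecomposable ordinals, that is, the powers of ω. The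
-- condition is put in terms of `⊕` because the widths of the pieces of a cover add up naturally.
ClosedUnder⊕ : Ord ℓ → Set (lsuc ℓ)
ClosedUnder⊕ θ = ∀ x y → x < θ → y < θ → x ⊕ y < θ

<-·+⁻ : (θ : Ord ℓ) (k : ℕ) {U : Set ℓ} {u : U → Ord ℓ} {x : Ord ℓ} →
        sup⁺ U u < θ → x < θ · k + sup⁺ U u →
        (∃₂ λ k′ u′ → k ≡ suc k′ × u′ < θ × x ≤ θ · k′ + u′) ⊎
        (Σ U λ i → x ≤ θ · k + u i)
-- `_+_` reduces only when its left argument is a constructor; `eq` recovers `θ · k` for the case
-- split on `k`.
<-·+⁻ θ k {U} {u} {x} u<θ p with θ · k in eq
<-·+⁻ θ k {U} {u} {x} u<θ (inj₂ j , p) | sup⁺ _ _ = inj₂ (j , p)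
<-·+⁻ θ k {U} {u} {x} u<θ (inj₁ i , p) | θk@(sup⁺ _ _) =
  inj₁ (lemma k (subst (x <_) (sym eq) (i , p)))
  where
  lemma : ∀ k → x < θ · k → ∃₂ λ k′ u′ → k ≡ suc k′ × u′ < θ × x ≤ θ · k′ + u′
  lemma zero ()
  lemma (suc k) q with <-+⁻ (θ · k) θ q
  -- Here `x` is already below `θ · k`, so any remainder below `θ` will do, and `sup⁺ U u` is one.
  ... | inj₁ r = k , sup⁺ U u , refl , u<θ , <⇒≤ x _ (<-≤-trans x (θ · k) _ r (≤-+ʳ _ _))
  ... | inj₂ (u′ , u′<θ , r) = k , u′ , refl , u′<θ , r

-- The inequality below is proved by recursion on (k, l, u, v), lexicographically: an ordinal
-- below θ · suc k + u is either at most θ · k + u′ for some u′ < θ or at most θ · suc k + u′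
-- for some u′ < u.

module _ {θ : Ord ℓ} (closed : ClosedUnder⊕ θ) where

  private
    Bound : ℕ → Ord ℓ → ℕ → Ord ℓ → Set ℓ
    Bound k u l v = u < θ → v < θ → (θ · k + u) ⊕ (θ · l + v) ≤ θ · (k ℕ.+ l) + (u ⊕ v)

    bound : ∀ k l →
            (∀ k′ → k ≡ suc k′ → ∀ u v → Bound k′ u l v) →
            (∀ l′ → l ≡ suc l′ → ∀ u v → Bound k u l′ v) →
            ∀ u v → Bound k u l v
    bound k l ihk ihl uu@(sup⁺ U u) vv@(sup⁺ V v) u<θ v<θ = ⊕-≤ (θ · k + uu) (θ · l + vv)
      (left  λ i → bound k l ihk ihl (u i) vv
        (≤-<-trans _ _ _ (<⇒≤ _ uu (i , ≤-refl (u i))) u<θ) v<θ)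
      (right λ i → bound k l ihk ihl uu (v i) u<θ
        (≤-<-trans _ _ _ (<⇒≤ _ vv (i , ≤-refl (v i))) v<θ))
      where
      open ≤-Reasoning
      left : (∀ i → (θ · k + u i) ⊕ (θ · l + vv) ≤ θ · (k ℕ.+ l) + (u i ⊕ vv)) →
             ∀ x → x < θ · k + uu → x ⊕ (θ · l + vv) < θ · (k ℕ.+ l) + (uu ⊕ vv)
      left ihu x p with <-·+⁻ θ k u<θ p
      ... | inj₁ (k′ , u′ , refl , u′<θ , q) = begin-strict
        x ⊕ (θ · l + vv)                  ≤⟨ ⊕-mono-≤ _ _ _ _ q (≤-refl (θ · l + vv)) ⟩
        (θ · k′ + u′) ⊕ (θ · l + vv)      ≤⟨ ihk k′ refl u′ vv u′<θ v<θ ⟩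
        -- The two remainders together stay below `θ`, so they fit into the block lost in passing
        -- from `k` to `k′`.
        θ · (k′ ℕ.+ l) + (u′ ⊕ vv)        <⟨ +-monoʳ-< _ _ _ (closed u′ vv u′<θ v<θ) ⟩
        θ · suc (k′ ℕ.+ l)                ≤⟨ ≤-+ʳ _ _ ⟩
        θ · suc (k′ ℕ.+ l) + (uu ⊕ vv)    ∎
      ... | inj₂ (i , q) = begin-strict
        x ⊕ (θ · l + vv)                  ≤⟨ ⊕-mono-≤ _ _ _ _ q (≤-refl (θ · l + vv)) ⟩
        (θ · k + u i) ⊕ (θ · l + vv)      ≤⟨ ihu i ⟩
        θ · (k ℕ.+ l) + (u i ⊕ vv)        <⟨ +-monoʳ-< _ _ _ (⊕-monoˡ-< _ _ _ (i , ≤-refl (u i))) ⟩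
        θ · (k ℕ.+ l) + (uu ⊕ vv)         ∎
      right : (∀ i → (θ · k + uu) ⊕ (θ · l + v i) ≤ θ · (k ℕ.+ l) + (uu ⊕ v i)) →
              ∀ y → y < θ · l + vv → (θ · k + uu) ⊕ y < θ · (k ℕ.+ l) + (uu ⊕ vv)
      right ihv y p with <-·+⁻ θ l v<θ p
      ... | inj₁ (l′ , v′ , refl , v′<θ , q) rewrite ℕ.+-suc k l′ = begin-strict
        (θ · k + uu) ⊕ y                  ≤⟨ ⊕-mono-≤ _ _ _ _ (≤-refl (θ · k + uu)) q ⟩
        (θ · k + uu) ⊕ (θ · l′ + v′)      ≤⟨ ihl l′ refl uu v′ u<θ v′<θ ⟩
        θ · (k ℕ.+ l′) + (uu ⊕ v′)        <⟨ +-monoʳ-< _ _ _ (closed uu v′ u<θ v′<θ) ⟩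
        θ · suc (k ℕ.+ l′)                ≤⟨ ≤-+ʳ _ _ ⟩
        θ · suc (k ℕ.+ l′) + (uu ⊕ vv)    ∎
      ... | inj₂ (i , q) = begin-strict
        (θ · k + uu) ⊕ y                  ≤⟨ ⊕-mono-≤ _ _ _ _ (≤-refl (θ · k + uu)) q ⟩
        (θ · k + uu) ⊕ (θ · l + v i)      ≤⟨ ihv i ⟩
        θ · (k ℕ.+ l) + (uu ⊕ v i)        <⟨ +-monoʳ-< _ _ _ (⊕-monoʳ-< uu _ _ (i , ≤-refl (v i))) ⟩
        θ · (k ℕ.+ l) + (uu ⊕ vv)         ∎

    bound-ℕ : ∀ k → (∀ k′ → k ≡ suc k′ → ∀ l u v → Bound k′ u l v) →
              ∀ l u v → Bound k u l v
    bound-ℕ k ih zero    = bound k zero (λ k′ eq → ih k′ eq zero) (λ _ ())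
    bound-ℕ k ih (suc l) = bound k (suc l) (λ k′ eq → ih k′ eq (suc l)) λ where
      _ refl → bound-ℕ k ih l

  ·+⊕·+ : ∀ k l u v → Bound k u l v
  ·+⊕·+ zero    = bound-ℕ zero (λ _ ())
  ·+⊕·+ (suc k) = bound-ℕ (suc k) λ where _ refl → ·+⊕·+ k

·⊕· : {θ : Ord ℓ} → ClosedUnder⊕ θ → 𝟘 {ℓ} < θ → ∀ k l → θ · k ⊕ θ · l ≤ θ · (k ℕ.+ l)
·⊕· {θ = θ} closed 0<θ k l = begin
  θ · k ⊕ θ · l               ≤⟨ ⊕-mono-≤ _ _ _ _ (≤-+ʳ _ 𝟘) (≤-+ʳ _ 𝟘) ⟩
  (θ · k + 𝟘) ⊕ (θ · l + 𝟘)   ≤⟨ ·+⊕·+ closed k l 𝟘 𝟘 0<θ 0<θ ⟩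
  θ · (k ℕ.+ l) + (𝟘 ⊕ 𝟘)     ≤⟨ +-mono-≤ _ _ _ _ (≤-refl (θ · (k ℕ.+ l))) (𝟘⊕y≤y 𝟘) ⟩
  θ · (k ℕ.+ l) + 𝟘           ≤⟨ x+𝟘≤x _ ⟩
  θ · (k ℕ.+ l)               ∎
  where
  open ≤-Reasoning
  x+𝟘≤x : (x : Ord ℓ) → x + 𝟘 {ℓ} ≤ x
  x+𝟘≤x (sup⁺ I f) (inj₁ i) = i , ≤-refl (f i)

ω^-mono-≤ : (x y : Ord ℓ) → x ≤ y → ω^ x ≤ ω^ y
ω^-mono-≤ (sup⁺ I f) (sup⁺ J g) p nothing = nothing , ≤-refl 𝟘
ω^-mono-≤ (sup⁺ I f) (sup⁺ J g) p (just (i , k)) with p i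
... | j , q = just (j , k) , ·-mono-≤ _ _ (ω^-mono-≤ (f i) (g j) q) (ℕ.≤-refl {k})

ω^·<ω^ : {x y : Ord ℓ} → x < y → ∀ k → ω^ x · k < ω^ y
ω^·<ω^ {y = sup⁺ J g} (j , p) k = just (j , k) , ·-mono-≤ _ _ (ω^-mono-≤ _ _ p) (ℕ.≤-refl {k})

<ω^⁻ : (x : Ord ℓ) {y : Ord ℓ} → y < ω^ x →
       y ≤ 𝟘 {ℓ} ⊎ ∃₂ λ (x′ : Ord ℓ) k → x′ < x × y ≤ ω^ x′ · k
<ω^⁻ (sup⁺ I f) (nothing      , p) = inj₁ p
<ω^⁻ (sup⁺ I f) (just (i , k) , p) = inj₂ (f i , k , (i , ≤-refl (f i)) , p)

ω^-mono-< : {x y : Ord ℓ} → x < y → ω^ x < ω^ y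
ω^-mono-< {x = x} p = ≤-<-trans _ _ _ (y≤x+y 𝟘 (ω^ x)) (ω^·<ω^ p 1)

𝟘<ω^ : (x : Ord ℓ) → 𝟘 {ℓ} < ω^ x
𝟘<ω^ (sup⁺ _ _) = nothing , ≤-refl 𝟘

-- Nontrivial arguments lie below finite multiples of powers with smaller exponents. Raising the
-- smaller of these exponents to the larger makes the powers equal, and `·⊕·` adds the multiples;
-- its closure hypothesis is the induction hypothesis.
ω^-closed : ExcludedMiddle ℓ → (x : Ord ℓ) → ClosedUnder⊕ (ω^ x)
ω^-closed em (sup⁺ I f) x y (nothing , p) q = ≤-<-trans _ _ _
  (≤-trans (x ⊕ y) (𝟘 ⊕ y) y (⊕-mono-≤ _ _ _ _ p (≤-refl y)) (𝟘⊕y≤y y)) q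
ω^-closed em (sup⁺ I f) x y p@(just _ , _) (nothing , q) = ≤-<-trans _ _ _
  (≤-trans (x ⊕ y) (x ⊕ 𝟘) x (⊕-mono-≤ _ _ _ _ (≤-refl x) q) (x⊕𝟘≤x x)) p
ω^-closed em (sup⁺ I f) x y (just (i , k) , p) (just (j , l) , q) with ≤-<-total em (f i) (f j)
... | inj₁ r = just (j , k ℕ.+ l) , (begin
  x ⊕ y                          ≤⟨ ⊕-mono-≤ _ _ _ _ p q ⟩
  (ω^ f i) · k ⊕ (ω^ f j) · l    ≤⟨ ⊕-mono-≤ _ _ _ _ (·-mono-≤ _ _ (ω^-mono-≤ _ _ r) (ℕ.≤-refl {k}))
                                                 (≤-refl ((ω^ f j) · l)) ⟩
  (ω^ f j) · k ⊕ (ω^ f j) · l    ≤⟨ ·⊕· (ω^-closed em (f j)) (𝟘<ω^ (f j)) k l ⟩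
  (ω^ f j) · (k ℕ.+ l)           ∎)
  where open ≤-Reasoning
... | inj₂ r = just (i , k ℕ.+ l) , (begin
  x ⊕ y                          ≤⟨ ⊕-mono-≤ _ _ _ _ p q ⟩
  (ω^ f i) · k ⊕ (ω^ f j) · l    ≤⟨ ⊕-mono-≤ _ _ _ _ (≤-refl ((ω^ f i) · k))
                                                 (·-mono-≤ _ _ (ω^-mono-≤ _ _ (<⇒≤ _ _ r)) (ℕ.≤-refl {l})) ⟩
  (ω^ f i) · k ⊕ (ω^ f i) · l    ≤⟨ ·⊕· (ω^-closed em (f i)) (𝟘<ω^ (f i)) k l ⟩
  (ω^ f i) · (k ℕ.+ l)           ∎)
  where open ≤-Reasoning

⨁-closed : {θ : Ord ℓ} → ClosedUnder⊕ θ → 𝟘 {ℓ} < θ →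
           (x : Vector (Ord ℓ) n) → (∀ i → x i < θ) → ⨁ x < θ
⨁-closed {n = zero}  closed 0<θ x p = 0<θ
⨁-closed {n = suc n} closed 0<θ x p =
  closed _ _ (p zero) (⨁-closed closed 0<θ (tail x) (p ∘ suc))

-- Widths of subsets

-- The width of P is approached as the length of a game: WidthAtMost P γ says that every move
-- x ∈ P can be answered by some δ < γ bounding the width of the part of P incomparable to x.

module _ (A : Preorder c ℓ₁ ℓ₂) where
  open Preorder A using (Carrier)

  infixl 6 _∩⊥_

  _∩⊥_ : Pred Carrier ℓ₂ → Carrier → Pred Carrier ℓ₂
  (P ∩⊥ x) y = P y × _∥_ A y x

  WidthAtMost WidthAtLeast : Pred Carrier ℓ₂ → Ord a → Set (a ⊔ c ⊔ ℓ₂)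
  WidthAtMost  P (sup⁺ J g) = ∀ x → P x → Σ J λ j → WidthAtMost (P ∩⊥ x) (g j)
  WidthAtLeast P (sup⁺ J g) = ∀ j → ∃ λ x → P x × WidthAtLeast (P ∩⊥ x) (g j)

module _ {A : Preorder c ℓ₁ ℓ₂} where
  open Preorder A using (Carrier)

  WidthAtMost-mono : {P Q : Pred Carrier ℓ₂} → P ⊆ Q → (γ : Ord a) (δ : Ord b) → γ ≤ δ →
                     WidthAtMost A Q γ → WidthAtMost A P δ
  WidthAtMost-mono P⊆Q (sup⁺ J g) (sup⁺ K h) γ≤δ w x x∈P with w x (P⊆Q x∈P)
  ... | j , w′ with γ≤δ j
  ...   | k , gj≤hk = k , WidthAtMost-mono (λ (y∈P , y∥x) → P⊆Q y∈P , y∥x) (g j) (h k) gj≤hk w′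

  WidthAtLeast-mono : {P Q : Pred Carrier ℓ₂} → P ⊆ Q → (γ : Ord a) (δ : Ord b) → γ ≤ δ →
                      WidthAtLeast A P δ → WidthAtLeast A Q γ
  WidthAtLeast-mono P⊆Q (sup⁺ J g) (sup⁺ K h) γ≤δ w j with γ≤δ j
  ... | k , gj≤hk with w k
  ...   | x , x∈P , w′ =
    x , P⊆Q x∈P , WidthAtLeast-mono (λ (y∈P , y∥x) → P⊆Q y∈P , y∥x) (g j) (h k) gj≤hk w′

  -- A move lies in `Q` or in `R` and is answered there, while the other part keeps its bound.
  -- Lowering one summand at a time is exactly the recursion that defines `⊕`.
  WidthAtMost-∪ : {P Q R : Pred Carrier ℓ₂} → (∀ {x} → P x → Q x ⊎ R x) → (γ δ : Ord a) →
                  WidthAtMost A Q γ → WidthAtMost A R δ → WidthAtMost A P (γ ⊕ δ)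
  WidthAtMost-∪ P⊆Q∪R γ@(sup⁺ J g) δ@(sup⁺ K h) wQ wR x x∈P = Sum.[
    (λ x∈Q → let j , w = wQ x x∈Q in
      inj₁ j , WidthAtMost-∪ (λ (y∈P , y∥x) → Sum.map₁ (_, y∥x) (P⊆Q∪R y∈P)) (g j) δ w wR) ,
    (λ x∈R → let k , w = wR x x∈R in
      inj₂ k , WidthAtMost-∪ (λ (y∈P , y∥x) → Sum.map₂ (_, y∥x) (P⊆Q∪R y∈P)) γ (h k) wQ w) ]
    (P⊆Q∪R x∈P)

  WidthAtMost-⋃ : {P : Pred Carrier ℓ₂} (Q : Fin n → Pred Carrier ℓ₂) →
                  (∀ {x} → P x → ∃ λ i → Q i x) →
                  (γ : Vector (Ord a) n) → (∀ i → WidthAtMost A (Q i) (γ i)) → WidthAtMost A P (⨁ γ)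
  WidthAtMost-⋃ {n = zero}  Q P⊆⋃Q γ w x x∈P with P⊆⋃Q x∈P
  ... | () , _
  WidthAtMost-⋃ {n = suc n} Q P⊆⋃Q γ w =
    WidthAtMost-∪ (λ x∈P → split (P⊆⋃Q x∈P)) (γ zero) (⨁ (tail γ)) (w zero)
      (WidthAtMost-⋃ (Q ∘ suc) id (tail γ) (w ∘ suc))
    where
    split : ∀ {x} → (∃ λ i → Q i x) → Q zero x ⊎ ∃ λ i → Q (suc i) x
    split (zero  , q) = inj₁ q
    split (suc i , q) = inj₂ (i , q)

  -- Play γ inside Q first; the moves made only shrink R d to some R d′, where β
  -- further moves remain.
  WidthAtLeast-+ : {D : Set d} (R : D → Pred Carrier ℓ₂) {P Q : Pred Carrier ℓ₂} (β γ : Ord a) →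
                   (∀ d → WidthAtLeast A (R d) β) →
                   (∀ {x} → Q x → ∀ d → ∃ λ d′ → R d′ ⊆ _∩⊥_ A (R d) x) →
                   Q ⊆ P → (d : D) → R d ⊆ P →
                   WidthAtLeast A Q γ → WidthAtLeast A P (β + γ)
  WidthAtLeast-+ R (sup⁺ I f) (sup⁺ J g) wR shrink Q⊆P d Rd⊆P wQ (inj₁ i) =
    WidthAtLeast-mono Rd⊆P (sup⁺ I f) (sup⁺ I f) (≤-refl (sup⁺ I f)) (wR d) i
  WidthAtLeast-+ R β@(sup⁺ I f) (sup⁺ J g) wR shrink Q⊆P d Rd⊆P wQ (inj₂ j) =
    let x , x∈Q , wQ′ = wQ j
        d′ , Rd′⊆Rd⊥x = shrink x∈Q d
    in x , Q⊆P x∈Q ,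
       WidthAtLeast-+ R β (g j) wR (shrink ∘ proj₁) (λ (y∈Q , y∥x) → Q⊆P y∈Q , y∥x) d′
         (λ y∈Rd′ → Rd⊆P (proj₁ (Rd′⊆Rd⊥x y∈Rd′)) , proj₂ (Rd′⊆Rd⊥x y∈Rd′)) wQ′

  WidthAtMost-intro : {P : Pred Carrier ℓ₂} (γ : Ord a) →
                 (∀ x → P x → ∃ λ (δ : Ord a) → δ < γ × WidthAtMost A (_∩⊥_ A P x) δ) →
                 WidthAtMost A P γ
  WidthAtMost-intro (sup⁺ J g) h x x∈P with h x x∈P
  ... | δ , (j , δ≤gj) , w = j , WidthAtMost-mono id δ (g j) δ≤gj w

  WidthAtLeast-elim : {P : Pred Carrier ℓ₂} (γ δ : Ord a) → δ < γ → WidthAtLeast A P γ →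
                 ∃ λ x → P x × WidthAtLeast A (_∩⊥_ A P x) δ
  WidthAtLeast-elim (sup⁺ J g) δ (j , δ≤gj) w with w j
  ... | x , x∈P , w′ = x , x∈P , WidthAtLeast-mono id δ (g j) δ≤gj w′

module _ {A : Preorder c ℓ₁ ℓ₂} {B : Preorder d p e} where
  private
    module A = Preorder A
    module B = Preorder B

  -- Order reflection sends incomparable elements to incomparable ones, so upper bounds pass from
  -- `Q` to `P` and lower bounds from `P` to `Q`. `map` takes the membership proof because the
  -- elements of `↓ α` contain one.
  record Reflection (P : Pred A.Carrier ℓ₂) (Q : Pred B.Carrier e) : Set (c ⊔ ℓ₂ ⊔ d ⊔ e) where
    field
      map      : ∀ x → P x → B.Carrier
      maps-to  : ∀ x x∈P → Q (map x x∈P)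
      reflects : ∀ x x∈P y y∈P → map x x∈P B.≲ map y y∈P → x A.≲ y

  open Reflection

  restrict : {P : Pred A.Carrier ℓ₂} {Q : Pred B.Carrier e} (f : Reflection P Q) →
             ∀ x x∈P → Reflection (_∩⊥_ A P x) (_∩⊥_ B Q (map f x x∈P))
  restrict f x x∈P .map y (y∈P , _) = map f y y∈P
  restrict f x x∈P .maps-to y (y∈P , y≴x , x≴y) =
    maps-to f y y∈P , y≴x ∘ reflects f y y∈P x x∈P , x≴y ∘ reflects f x x∈P y y∈P
  restrict f x x∈P .reflects y (y∈P , _) z (z∈P , _) = reflects f y y∈P z z∈P

  WidthAtMost-reflect : {P : Pred A.Carrier ℓ₂} {Q : Pred B.Carrier e} → Reflection P Q →
                        (γ : Ord a) → WidthAtMost B Q γ → WidthAtMost A P γ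
  WidthAtMost-reflect f (sup⁺ J g) w x x∈P =
    let j , w′ = w (map f x x∈P) (maps-to f x x∈P)
    in j , WidthAtMost-reflect (restrict f x x∈P) (g j) w′

  WidthAtLeast-reflect : {P : Pred A.Carrier ℓ₂} {Q : Pred B.Carrier e} → Reflection P Q →
                         (γ : Ord a) → WidthAtLeast A P γ → WidthAtLeast B Q γ
  WidthAtLeast-reflect f (sup⁺ J g) w j =
    let x , x∈P , w′ = w j
    in map f x x∈P , maps-to f x x∈P , WidthAtLeast-reflect (restrict f x x∈P) (g j) w′

-- From the game to ranks in the forest of antichains.

module _ {A : Preorder c ℓ₁ ℓ₂} where
  open Preorder A using (Carrier)
  open Antichain

  -- Follows the storage order of antichains, so that extending a sequence by `x` is, by definition,
  -- the move `x` of the game.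
  Beyond : List Carrier → Pred Carrier ℓ₂
  Beyond []       = const ⊤
  Beyond (x ∷ xs) = _∩⊥_ A (Beyond xs) x

  private
    elements : Antichain A → List Carrier
    elements s = toList (sequence s)

    ∈-Beyond : ∀ {x xs} → All (_∥_ A x) xs → Beyond xs x
    ∈-Beyond []         = tt
    ∈-Beyond (x∥y ∷ ps) = ∈-Beyond ps , x∥y

    child-elements : ∀ {t s} ((x , _) : _IsChildOf_ A t s) → elements t ≡ x ∷ elements s
    child-elements (_ , eq) = cong toList eq

    child-∈-Beyond : ∀ {t s} ((x , _) : _IsChildOf_ A t s) → Beyond (elements s) x
    child-∈-Beyond {t} {s} t◃s
      with subst (AllPairs (_∥_ A)) (child-elements {t} {s} t◃s) (incomparable t)
    ... | p ∷ _ = ∈-Beyond p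

    child-width : ∀ {t s} → _IsChildOf_ A t s → {J : Set a} {g : J → Ord a} →
                  WidthAtMost A (Beyond (elements s)) (sup⁺ J g) →
                  Σ J λ j → WidthAtMost A (Beyond (elements t)) (g j)
    child-width {t = t} {s} t◃s {g = g} w =
      let j , w′ = w (proj₁ t◃s) (child-∈-Beyond {t} {s} t◃s)
      in j , subst (λ xs → WidthAtMost A (Beyond xs) (g j)) (sym (child-elements {t} {s} t◃s)) w′

  acc-Antichain : ∀ s (γ : Ord a) → WidthAtMost A (Beyond (elements s)) γ → Acc (_IsChildOf_ A) s
  acc-Antichain s (sup⁺ J g) w = acc λ {t} t◃s →
    let j , w′ = child-width {t = t} {s} t◃s w in acc-Antichain t (g j) w′

  rank-≤ : ∀ s ac (γ : Ord a) → WidthAtMost A (Beyond (elements s)) γ → rank A s ac ≤ γ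
  rank-≤ s (acc rs) (sup⁺ J g) w (t , t◃s) =
    let j , w′ = child-width {t = t} {s} t◃s w in j , rank-≤ t (rs t◃s) (g j) w′

  -- A nonempty sequence has used up at least one move. The answer to its first element, which is
  -- stored last, remains a bound, since the later elements only shrink the set. The strict
  -- inequality matches the `+1` in the definition of the width.
  WidthAtMost-Beyond : (γ : Ord a) → WidthAtMost A (const ⊤) γ → ∀ s →
                  Σ (Ord a) λ δ → δ < γ × WidthAtMost A (Beyond (elements s)) δ
  WidthAtMost-Beyond (sup⁺ J g) w s =
    let j , w′ = go (List⁺.head (sequence s)) (List⁺.tail (sequence s)) (incomparable s)
    in g j , (j , ≤-refl (g j)) , w′
    where
    go : ∀ x xs → AllPairs (_∥_ A) (x ∷ xs) → Σ J λ j → WidthAtMost A (Beyond (x ∷ xs)) (g j)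
    go x []       _        = w x tt
    go x (y ∷ ys) (p ∷ ps) with go y ys ps
    ... | j , w′ = j , lemma (g j) w′
      where
      lemma : ∀ δ → WidthAtMost A (Beyond (y ∷ ys)) δ → WidthAtMost A (Beyond (x ∷ y ∷ ys)) δ
      lemma δ = WidthAtMost-mono proj₁ δ δ (≤-refl δ)

  rank-≥ : ∀ s ac (γ : Ord a) → WidthAtLeast A (Beyond (elements s)) γ → γ ≤ rank A s ac
  rank-≥ s (acc rs) (sup⁺ J g) w j =
    let x , x∈ , w′ = w j
        t = record { sequence = x ∷ elements s ; incomparable = Beyond⇒All x∈ ∷ incomparable s }
    in (t , x , refl) , rank-≥ t (rs (x , refl)) (g j) w′
    where
    Beyond⇒All : ∀ {x xs} → Beyond xs x → All (_∥_ A x) xs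
    Beyond⇒All {xs = []}     _         = []
    Beyond⇒All {xs = x ∷ xs} (q , y∥x) = y∥x ∷ Beyond⇒All q

  width-exact : (γ : Ord a) → WidthAtMost A (const ⊤) γ → WidthAtLeast A (const ⊤) γ → HasWidth A γ
  width-exact γ@(sup⁺ J g) w≤ w≥ = wf , upper , lower′
    where
    wf : WellFounded (_IsChildOf_ A)
    wf s = let δ , _ , w = WidthAtMost-Beyond γ w≤ s in acc-Antichain s δ w

    upper : width A wf ≤ γ
    upper s = let δ , δ<γ , w = WidthAtMost-Beyond γ w≤ s in
      ≤-<-trans _ δ γ (rank-≤ s (wf s) δ w) δ<γ

    lower′ : γ ≤ width A wf
    lower′ j =
      -- The opening move alone, as a one-element sequence, already has rank at least `g j`.
      let x , _ , w = w≥ j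
          s = record { sequence = x ∷ [] ; incomparable = [] ∷ [] }
      in s , rank-≥ s (wf s) (g j) w

-- Boxes of ordinals

_[_≔_] : {A : Set a} → Vector A n → Fin n → A → Vector A n
xs [ p ≔ x ] = updateAt xs p (const x)

module _ {A : Set a} (Q : Fin n → A → Set b) (xs : Vector A n) (p : Fin n) {f : A → A} where

  updateAt⁺ : Q p (f (xs p)) → (∀ i → i ≢ p → Q i (xs i)) → ∀ i → Q i (updateAt xs p f i)
  updateAt⁺ q r i with i ≟ p
  ... | yes refl = subst (Q p) (sym (updateAt-updates p xs)) q
  ... | no  i≢p  = subst (Q i) (sym (updateAt-minimal i p xs i≢p)) (r i i≢p)

  updateAt⁻-≡ : (∀ i → Q i (updateAt xs p f i)) → Q p (f (xs p))
  updateAt⁻-≡ q = subst (Q p) (updateAt-updates p xs) (q p)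

  updateAt⁻-≢ : (∀ i → Q i (updateAt xs p f i)) → ∀ i → i ≢ p → Q i (xs i)
  updateAt⁻-≢ q i i≢p = subst (Q i) (updateAt-minimal i p xs i≢p) (q i)

-- One ambient order for all products of the same length: reductions and slices become predicates on
-- a fixed carrier.
Ordⁿ : ∀ ℓ → ℕ → Preorder (lsuc ℓ) ℓ ℓ
Ordⁿ ℓ n = Π-preorder {n = n} λ _ → ≤-preorder ℓ

Box : Vector (Ord ℓ) n → Pred (Vector (Ord ℓ) n) ℓ
Box β x = ∀ i → x i < β i

module _ {β x : Vector (Ord ℓ) n} {p : Fin n} {b : Ord ℓ} where

  Box-≔⁺ : x p < b → (∀ i → i ≢ p → x i < β i) → Box (β [ p ≔ b ]) x
  Box-≔⁺ = updateAt⁺ (λ i → x i <_) β p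

  Box-≔⁻-≡ : Box (β [ p ≔ b ]) x → x p < b
  Box-≔⁻-≡ = updateAt⁻-≡ (λ i → x i <_) β p

  Box-≔⁻-≢ : Box (β [ p ≔ b ]) x → ∀ i → i ≢ p → x i < β i
  Box-≔⁻-≢ = updateAt⁻-≢ (λ i → x i <_) β p

updateAt-reflection : (p : Fin n) (h : Ord ℓ → Ord ℓ) {P Q : Pred (Vector (Ord ℓ) n) ℓ} →
                      (∀ x → P x → Q (updateAt x p h)) →
                      (∀ x y → P x → P y → h (x p) ≤ h (y p) → x p ≤ y p) →
                      Reflection {A = Ordⁿ ℓ n} {B = Ordⁿ ℓ n} P Q
updateAt-reflection p h {P} into h-reflects = record
  { map      = λ x _ → updateAt x p h
  ; maps-to  = into
  ; reflects = λ x x∈P y y∈P hx≤hy i → go x x∈P y y∈P hx≤hy i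
  }
  where
  go : ∀ x → P x → ∀ y → P y → (∀ i → updateAt x p h i ≤ updateAt y p h i) → ∀ i → x i ≤ y i
  go x x∈P y y∈P hx≤hy i with i ≟ p
  ... | yes refl = h-reflects x y x∈P y∈P (subst (h (x p) ≤_) (updateAt-updates p y)
                     (updateAt⁻-≡ (λ i u → u ≤ updateAt y p h i) x p hx≤hy))
  ... | no i≢p = subst (x i ≤_) (updateAt-minimal i p y i≢p)
                     (updateAt⁻-≢ (λ i u → u ≤ updateAt y p h i) x p hx≤hy i i≢p)

module _ (em : ExcludedMiddle ℓ) where

  -- Induction on the number of slices. Left subtraction of `θ · k` in coordinate `p` brings the top
  -- slice down into the box with side `θ`, and closure keeps the accumulated natural sum below `Ω`.
  WidthAtMost-· : {β : Vector (Ord ℓ) n} {p : Fin n} {θ γ Ω : Ord ℓ} →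
             ClosedUnder⊕ Ω → γ < Ω → WidthAtMost (Ordⁿ ℓ n) (Box (β [ p ≔ θ ])) γ →
             ∀ k → ∃ λ δ → δ < Ω × WidthAtMost (Ordⁿ ℓ n) (Box (β [ p ≔ θ · k ])) δ
  WidthAtMost-· {β = β} {p} {γ = γ} {Ω} closed γ<Ω w zero =
    𝟘 , ≤-<-trans 𝟘 γ Ω (𝟘≤ γ) γ<Ω , λ x x∈ → contradiction (Box-≔⁻-≡ {β = β} {p = p} x∈) ≮𝟘
  WidthAtMost-· {n = n} {β} {p} {θ} {γ} {Ω} closed γ<Ω w (suc k) =
    let δ , δ<Ω , w′ = WidthAtMost-· {β = β} {p} closed γ<Ω w k
    in δ ⊕ γ , closed δ γ δ<Ω γ<Ω , WidthAtMost-∪ split δ γ w′ (WidthAtMost-reflect lower-top γ w)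
    where
    Top : Pred (Vector (Ord ℓ) n) ℓ
    Top x = Box (β [ p ≔ θ · suc k ]) x × θ · k ≤ x p

    split : ∀ {x} → Box (β [ p ≔ θ · suc k ]) x → Box (β [ p ≔ θ · k ]) x ⊎ Top x
    split {x} x∈ with ≤-<-total em (θ · k) (x p)
    ... | inj₁ θk≤x = inj₂ (x∈ , θk≤x)
    ... | inj₂ x<θk = inj₁ (Box-≔⁺ {p = p} x<θk (Box-≔⁻-≢ {β = β} {p = p} x∈))

    lower-top : Reflection Top (Box (β [ p ≔ θ ]))
    lower-top = updateAt-reflection p (_∸ θ · k)
      (λ x (x∈ , θk≤x) → Box-≔⁺ {p = p}
        (subst (_< θ) (sym (updateAt-updates p x)) (+-cancelˡ-< (θ · k) _ θ
          (≤-<-trans _ (x p) _ (proj₁ (+-∸ em (θ · k) (x p) θk≤x)) (Box-≔⁻-≡ {β = β} {p = p} x∈))))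
        λ i i≢p → subst (_< β i) (sym (updateAt-minimal i p x i≢p))
          (Box-≔⁻-≢ {β = β} {p = p} x∈ i i≢p))
      λ x y (_ , θk≤x) (_ , θk≤y) x∸≤y∸ → begin
        x p                        ≤⟨ proj₂ (+-∸ em (θ · k) (x p) θk≤x) ⟩
        θ · k + (x p ∸ θ · k)      ≤⟨ +-mono-≤ _ _ _ _ (≤-refl (θ · k)) x∸≤y∸ ⟩
        θ · k + (y p ∸ θ · k)      ≤⟨ proj₁ (+-∸ em (θ · k) (y p) θk≤y) ⟩
        y p                        ∎
      where open ≤-Reasoning

-- `WidthAtLeast-+` with `γ` played in the top slice and `γ · k` in the lower slices above some
-- `c < β q`. Left addition of `c` in coordinate `q` copies all of the lower slices there, because
-- `β q` is closed.
WidthAtLeast-· : {β : Vector (Ord ℓ) n} {p q : Fin n} {θ γ : Ord ℓ} → q ≢ p →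
            ClosedUnder⊕ (β q) → 𝟙 {ℓ} < β q → WidthAtLeast (Ordⁿ ℓ n) (Box (β [ p ≔ θ ])) γ →
            ∀ k → WidthAtLeast (Ordⁿ ℓ n) (Box (β [ p ≔ θ · k ])) (γ · k)
WidthAtLeast-· q≢p closed 1<βq w zero ()
WidthAtLeast-· {ℓ} {n} {β} {p} {q} {θ} {γ} q≢p closed 1<βq w (suc k) =
  WidthAtLeast-+ {D = Σ (Ord ℓ) (_< β q)} Above {Q = Top} (γ · k) γ
    (λ (c , c<βq) → WidthAtLeast-reflect (shift c c<βq) (γ · k)
      (WidthAtLeast-· {β = β} {p} q≢p closed 1<βq w k))
    (λ {x} → shrink {x})
    proj₁
    (𝟘 , <-≤-trans 𝟘 𝟙 (β q) (≤⇒<sucᵒ (≤-refl 𝟘)) (<⇒≤ 𝟙 (β q) 1<βq))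
    (λ (x∈ , _) → Box-≔⁺ {p = p} (<-≤-trans _ _ _ (Box-≔⁻-≡ {β = β} {p = p} x∈) (≤-+ʳ (θ · k) θ))
      (Box-≔⁻-≢ {β = β} {p = p} x∈))
    (WidthAtLeast-reflect lift-top γ w)
  where
  Top : Pred (Vector (Ord ℓ) n) ℓ
  Top x = Box (β [ p ≔ θ · suc k ]) x × θ · k ≤ x p

  Above : Σ (Ord ℓ) (_< β q) → Pred (Vector (Ord ℓ) n) ℓ
  Above (c , _) x = Box (β [ p ≔ θ · k ]) x × c ≤ x q

  lift-top : Reflection (Box (β [ p ≔ θ ])) Top
  lift-top = updateAt-reflection p (θ · k +_)
    (λ x x∈ →
      Box-≔⁺ {p = p} (subst (_< θ · suc k) (sym (updateAt-updates p x))
          (+-monoʳ-< (θ · k) (x p) θ (Box-≔⁻-≡ {β = β} {p = p} x∈)))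
        (λ i i≢p → subst (_< β i) (sym (updateAt-minimal i p x i≢p))
          (Box-≔⁻-≢ {β = β} {p = p} x∈ i i≢p)) ,
      subst (θ · k ≤_) (sym (updateAt-updates p x)) (≤-+ʳ (θ · k) (x p)))
    λ x y _ _ → +-cancelˡ-≤ (θ · k) (x p) (y p)

  shift : ∀ c (c<βq : c < β q) → Reflection (Box (β [ p ≔ θ · k ])) (Above (c , c<βq))
  shift c c<βq = updateAt-reflection q (c +_)
    (λ x x∈ →
      updateAt⁺ (λ i u → u < (β [ p ≔ θ · k ]) i) x q
        (subst (c + x q <_) (sym (updateAt-minimal q p β q≢p))
          (≤-<-trans _ (c ⊕ x q) _ (+≤⊕ c (x q))
            (closed c (x q) c<βq (Box-≔⁻-≢ {β = β} {p = p} x∈ q q≢p))))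
        (λ i _ → x∈ i) ,
      subst (c ≤_) (sym (updateAt-updates q x)) (≤-+ʳ c (x q)))
    λ x y _ _ → +-cancelˡ-≤ c (x q) (y q)

  shrink : ∀ {x} → Top x → ∀ d → ∃ λ d′ → Above d′ ⊆ _∩⊥_ (Ordⁿ ℓ n) (Above d) x
  shrink {x} (x∈ , θk≤x) (c , c<βq) =
    -- The new bound is at least `c`, to stay inside `Above d`, and exceeds `x q`, so that nothing
    -- above it lies below `x`; closure keeps it below `β q`.
    (c ⊕ (x q ⊕ 𝟙) , closed _ _ c<βq (closed _ _ (Box-≔⁻-≢ {β = β} {p = p} x∈ q q≢p) 1<βq)) ,
    λ {y} (y∈ , c′≤y) →
      (y∈ , ≤-trans c _ (y q) (x≤x⊕y c _) c′≤y) ,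
      (λ y≤x → <-irrefl (x q) (begin-strict
        x q              ≤⟨ x≤x⊕y (x q) 𝟘 ⟩
        x q ⊕ 𝟘          <⟨ ⊕-monoʳ-< (x q) 𝟘 𝟙 (≤⇒<sucᵒ (≤-refl 𝟘)) ⟩
        x q ⊕ 𝟙          ≤⟨ y≤x⊕y c _ ⟩
        c ⊕ (x q ⊕ 𝟙)    ≤⟨ c′≤y ⟩
        y q              ≤⟨ y≤x q ⟩
        x q              ∎)) ,
      (λ x≤y → <-irrefl (x p) (begin-strict
        x p              ≤⟨ x≤y p ⟩
        y p              <⟨ Box-≔⁻-≡ {β = β} {p = p} y∈ ⟩
        θ · k            ≤⟨ θk≤x ⟩
        x p              ∎))
    where open ≤-Reasoning

≤⨁ : (x : Vector (Ord ℓ) n) → ∀ i → x i ≤ ⨁ x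
≤⨁ x zero    = x≤x⊕y (x zero) _
≤⨁ x (suc i) = ≤-trans (x (suc i)) (⨁ (tail x)) _ (≤⨁ (tail x) i) (y≤x⊕y (x zero) _)

⨁-≔-< : (x : Vector (Ord ℓ) n) (p : Fin n) {u : Ord ℓ} → u < x p → ⨁ (x [ p ≔ u ]) < ⨁ x
⨁-≔-< x zero    u<xp = ⊕-monoˡ-< _ _ _ u<xp
⨁-≔-< x (suc p) u<xp = ⊕-monoʳ-< (x zero) _ _ (⨁-≔-< (tail x) p u<xp)

<⨁⁻ : (x : Vector (Ord ℓ) n) {y : Ord ℓ} → y < ⨁ x →
      ∃₂ λ p (u : Ord ℓ) → u < x p × y ≤ ⨁ (x [ p ≔ u ])
<⨁⁻ {n = zero}  x y<⨁ = contradiction y<⨁ ≮𝟘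
<⨁⁻ {n = suc n} x {y} y<⨁ with <-⊕⁻ (x zero) (⨁ (tail x)) y<⨁
... | inj₁ (u , u<x₀ , y≤) = zero , u , u<x₀ , y≤
... | inj₂ (v , v<⨁ , y≤) with <⨁⁻ (tail x) v<⨁
...   | p , u , u<xp , v≤ = suc p , u , u<xp ,
        ≤-trans y (x zero ⊕ v) _ y≤ (⊕-mono-≤ _ _ _ _ (≤-refl (x zero)) v≤)

-- Boxes with sides powers of ω

Box^ : Vector (Ord ℓ) n → Pred (Vector (Ord ℓ) n) ℓ
Box^ α = Box (ω^_ ∘ α)

-- Stated pointwise because these vectors are functions.
ω^-≔ : (α : Vector (Ord ℓ) n) (p : Fin n) (a : Ord ℓ) →
       ∀ i → ω^ (α [ p ≔ a ]) i ≡ ((ω^_ ∘ α) [ p ≔ ω^ a ]) i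
ω^-≔ α p a = map-updateAt {f = ω^_} {g = const a} {h = const (ω^ a)} (λ _ → refl) α p

AtMost^ AtLeast^ : Vector (Ord ℓ) n → Ord ℓ → Set (lsuc ℓ)
AtMost^  {ℓ} {n} α γ = WidthAtMost  (Ordⁿ ℓ n) (Box^ α) (ω^ γ)
AtLeast^ {ℓ} {n} α γ = WidthAtLeast (Ordⁿ ℓ n) (Box^ α) (ω^ γ)

module _ (em : ExcludedMiddle ℓ) where

  ≰⇒∃> : (x y : Vector (Ord ℓ) n) → ¬ (∀ i → x i ≤ y i) → ∃ λ i → y i < x i
  ≰⇒∃> x y x≰y with ¬∀⟶∃¬ _ (λ i → x i ≤ y i) (λ _ → em) x≰y
  ... | i , xi≰yi with ≤-<-total em (x i) (y i)
  ...   | inj₁ xi≤yi = contradiction xi≤yi xi≰yi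
  ...   | inj₂ yi<xi = i , yi<xi

  AtMost^-step : (α : Vector (Ord ℓ) n) (γ : Ord ℓ) →
                 (∀ p a → a < α p → ∃ λ γ′ → γ′ < γ × AtMost^ (α [ p ≔ a ]) γ′) →
                 AtMost^ α γ
  AtMost^-step {n = n} α γ reduce = WidthAtMost-intro (ω^ γ) λ x x∈ →
    let δ = λ i → proj₁ (below x i (x∈ i))
    in ⨁ δ ,
       ⨁-closed (ω^-closed em γ) (𝟘<ω^ γ) δ (λ i → proj₁ (proj₂ (below x i (x∈ i)))) ,
       WidthAtMost-⋃ (λ i y → Box^ α y × y i < x i)
         (λ {y} (y∈ , _ , x≰y) → let i , yi<xi = ≰⇒∃> x y x≰y in i , y∈ , yi<xi)
         δ (λ i → proj₂ (proj₂ (below x i (x∈ i))))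
    where
    below : ∀ x i → x i < ω^ α i →
            ∃ λ δ → δ < ω^ γ × WidthAtMost (Ordⁿ ℓ n) (λ y → Box^ α y × y i < x i) δ
    below x i xi< with <ω^⁻ (α i) xi<
    ... | inj₁ xi≤0 = 𝟘 , 𝟘<ω^ γ , λ y (_ , yi<xi) →
          contradiction (<-≤-trans (y i) (x i) 𝟘 yi<xi xi≤0) ≮𝟘
    ... | inj₂ (a , k , a<αi , xi≤) =
          let γ′ , γ′<γ , w = reduce i a a<αi
              δ , δ<ω^γ , w′ = WidthAtMost-· em {β = ω^_ ∘ α} {p = i}
                (ω^-closed em γ) (ω^-mono-< γ′<γ)
                (WidthAtMost-mono (λ {y} y∈ j → subst (y j <_) (sym (ω^-≔ α i a j)) (y∈ j))
                  (ω^ γ′) (ω^ γ′) (≤-refl (ω^ γ′)) w) k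
          in δ , δ<ω^γ , WidthAtMost-mono
               (λ {y} (y∈ , yi<xi) → Box-≔⁺ {p = i} (<-≤-trans (y i) (x i) _ yi<xi xi≤)
                  (λ j _ → y∈ j))
               δ δ (≤-refl δ) w′

  -- A coordinate with exponent 0 ranges over `ω^ 𝟘`, so it is always 0. The order is then that of
  -- coordinate `p`, which is total, and nothing remains after one move.
  AtMost^-chain : (α : Vector (Ord ℓ) n) (p : Fin n) → (∀ i → i ≢ p → α i ≤ 𝟘 {ℓ}) →
                  ∀ γ → AtMost^ α γ
  AtMost^-chain {n = n} α p α≤0 γ = WidthAtMost-intro {A = Ordⁿ ℓ n} (ω^ γ) λ x x∈ →
    𝟘 , 𝟘<ω^ γ , λ y (y∈ , y≰x , x≰y) → contradiction (x≰y , y≰x) (comparable x x∈ y y∈)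
    where
    comparable : ∀ x → Box^ α x → ∀ y → Box^ α y → ¬ (¬ (∀ i → x i ≤ y i) × ¬ (∀ i → y i ≤ x i))
    dominate : ∀ {x} y → Box^ α x → x p ≤ y p → ∀ i → x i ≤ y i
    dominate {x} y x∈ xp≤yp i with i ≟ p
    ... | yes refl = xp≤yp
    ... | no i≢p with <ω^⁻ (α i) (x∈ i)
    ...   | inj₁ xi≤0 = ≤-trans (x i) (𝟘 {ℓ}) (y i) xi≤0 (𝟘≤ (y i))
    ...   | inj₂ (a , _ , a<αi , _) = contradiction (<-≤-trans a (α i) (𝟘 {ℓ}) a<αi (α≤0 i i≢p)) ≮𝟘

    comparable x x∈ y y∈ (x≰y , y≰x) with ≤-<-total em (x p) (y p)
    ... | inj₁ xp≤yp = x≰y (dominate y x∈ xp≤yp)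
    ... | inj₂ yp<xp = y≰x (dominate x y∈ (<⇒≤ (y p) (x p) yp<xp))

  -- The recursion is on γ because vectors of trees have no structural order.
  AtMost^-⨁ : (γ : Ord ℓ) (α : Vector (Ord ℓ) n) → ⨁ α ≤ γ → AtMost^ α γ
  AtMost^-⨁ γ@(sup⁺ J g) α ⨁≤γ = AtMost^-step α γ λ p a a<αp →
    let j , ⨁≤gj = <-≤-trans _ _ γ (⨁-≔-< α p a<αp) ⨁≤γ
    in g j , (j , ≤-refl (g j)) , AtMost^-⨁ (g j) (α [ p ≔ a ]) ⨁≤gj

  ⨁≤𝟙⇒one-nonzero : (α : Vector (Ord ℓ) (suc n)) → ⨁ α ≤ 𝟙 {ℓ} → ∃ λ p → ∀ i → i ≢ p → α i ≤ 𝟘 {ℓ}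
  ⨁≤𝟙⇒one-nonzero {n = zero}  α ⨁≤1 = zero , λ { zero 0≢0 → contradiction refl 0≢0 }
  ⨁≤𝟙⇒one-nonzero {n = suc n} α ⨁≤1 with ≤-<-total em (α zero) 𝟘
  ... | inj₁ α₀≤0 =
    let p , others = ⨁≤𝟙⇒one-nonzero (tail α)
          (≤-trans (⨁ (tail α)) (⨁ α) (𝟙 {ℓ}) (y≤x⊕y (α zero) _) ⨁≤1)
    in suc p , λ { zero _ → α₀≤0 ; (suc i) i≢p → others i (i≢p ∘ cong suc) }
  ... | inj₂ 0<α₀ = zero , λ where
    zero    0≢0 → contradiction refl 0≢0
    (suc i) _   → ≤-trans (α (suc i)) (⨁ (tail α)) 𝟘 (≤⨁ (tail α) i)
      (proj₂ (<-≤-trans (⨁ (tail α)) (⨁ α) (𝟙 {ℓ})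
        (≤-<-trans _ _ _ (y≤x⊕y 𝟘 _) (⊕-monoˡ-< 𝟘 (α zero) _ 0<α₀)) ⨁≤1))

  -- The exponent saves 1 against `AtMost^-⨁` because the recursion stops at chains, before all
  -- exponents are 0. The tail sum is bounded by `suc s`, so `s` is the bound after subtracting 1.
  AtMost^-finite-tail : (γ : Ord ℓ) (α : Vector (Ord ℓ) (suc n)) (s : ℕ) →
                        ⨁ (tail α) ≤ fromℕ {ℓ} (suc s) → head α ⊕ fromℕ s ≤ γ → AtMost^ α γ
  AtMost^-finite-tail γ@(sup⁺ J g) α zero ⨁≤ η≤γ with ≤-<-total em (head α) 𝟘
  ... | inj₁ α₀≤0 =
    let p , others = ⨁≤𝟙⇒one-nonzero α
          (≤-trans (⨁ α) (𝟘 ⊕ 𝟙) (𝟙 {ℓ}) (⊕-mono-≤ _ _ _ _ α₀≤0 ⨁≤) (𝟘⊕y≤y 𝟙))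
    in AtMost^-chain α p others γ
  ... | inj₂ 0<α₀ = AtMost^-step α γ λ where
    zero a a<α₀ →
      let j , η≤gj = <-≤-trans _ _ γ (⊕-monoˡ-< a (head α) 𝟘 a<α₀) η≤γ
      in g j , (j , ≤-refl (g j)) , AtMost^-finite-tail (g j) (α [ zero ≔ a ]) zero ⨁≤ η≤gj
    -- The tail sum falls below 1, which leaves a chain along coordinate 0. Any exponent below `γ`
    -- bounds it, and 0 is one since the head is positive.
    (suc p) a a<αp →
      𝟘 ,
      <-≤-trans 𝟘 (head α ⊕ 𝟘) γ (<-≤-trans 𝟘 (head α) _ 0<α₀ (x≤x⊕y (head α) 𝟘)) η≤γ ,
      AtMost^-chain (α [ suc p ≔ a ]) zero (λ where
        zero    0≢0 → contradiction refl 0≢0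
        (suc i) _   → ≤-trans ((tail α [ p ≔ a ]) i) (⨁ (tail α [ p ≔ a ])) 𝟘 (≤⨁ (tail α [ p ≔ a ]) i)
          (proj₂ (<-≤-trans _ (⨁ (tail α)) (𝟙 {ℓ}) (⨁-≔-< (tail α) p a<αp) ⨁≤))) 𝟘
  AtMost^-finite-tail γ@(sup⁺ J g) α (suc s) ⨁≤ η≤γ = AtMost^-step α γ λ where
    zero a a<α₀ →
      let j , η≤gj = <-≤-trans _ _ γ (⊕-monoˡ-< a (head α) (fromℕ (suc s)) a<α₀) η≤γ
      in g j , (j , ≤-refl (g j)) , AtMost^-finite-tail (g j) (α [ zero ≔ a ]) (suc s) ⨁≤ η≤gj
    (suc p) a a<αp →
      let j , η≤gj = <-≤-trans _ _ γ (⊕-monoʳ-< (head α) (fromℕ s) (fromℕ (suc s))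
            (≤⇒<sucᵒ (≤-refl _))) η≤γ
      in g j , (j , ≤-refl (g j)) , AtMost^-finite-tail (g j) (α [ suc p ≔ a ]) s
           (proj₂ (<-≤-trans _ (⨁ (tail α)) (fromℕ (suc (suc s))) (⨁-≔-< (tail α) p a<αp) ⨁≤)) η≤gj

  -- The children of the tree `ω^ γ` are `𝟘` and the `ω^ γ′ · k`. Any point answers the first; for
  -- the others `WidthAtLeast-·` multiplies the width of a reduction, using the positive `α q` for
  -- room.
  AtLeast^-step : (α : Vector (Ord ℓ) n) (γ : Ord ℓ) →
                  (∀ γ′ → γ′ < γ → ∃₂ λ p q → q ≢ p × 𝟘 {ℓ} < α q ×
                    ∃ λ a → a < α p × AtLeast^ (α [ p ≔ a ]) γ′) →
                  AtLeast^ α γ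
  AtLeast^-step α (sup⁺ J g) reduce nothing = const 𝟘 , (λ i → 𝟘<ω^ (α i)) , λ ()
  AtLeast^-step {n = n} α (sup⁺ J g) reduce (just (j , k)) =
    let p , q , q≢p , 0<αq , a , a<αp , w = reduce (g j) (j , ≤-refl (g j))
        θ = ω^ g j
        w′ = WidthAtLeast-mono {A = Ordⁿ ℓ n} (λ {x} x∈ i → subst (x i <_) (ω^-≔ α p a i) (x∈ i))
               θ θ (≤-refl θ) w
        -- The extra copy of `θ` pays for the move itself, after which `θ · k` must still remain.
        w″ = WidthAtLeast-· {β = ω^_ ∘ α} {p} {q} q≢p (ω^-closed em (α q)) (𝟙<ω^ 0<αq) w′ (suc k)
    in WidthAtLeast-elim (θ · suc k) (θ · k)
         (≤-<-trans (θ · k) (θ · k + 𝟘) _ (≤-+ʳ (θ · k) 𝟘) (+-monoʳ-< (θ · k) 𝟘 θ (𝟘<ω^ (g j))))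
         (WidthAtLeast-mono
           (λ {x} x∈ i → Box-≔-⊆ x (<⇒≤ _ _ (ω^·<ω^ a<αp (suc k))) x∈ i)
           (θ · suc k) (θ · suc k) (≤-refl (θ · suc k)) w″)
    where
    𝟙<ω^ : ∀ {x} → 𝟘 {ℓ} < x → 𝟙 {ℓ} < ω^ x
    𝟙<ω^ {x} 0<x = ≤-<-trans 𝟙 _ (ω^ x)
      (<⇒sucᵒ≤ (<-≤-trans 𝟘 (ω^ 𝟘 {ℓ}) _ (𝟘<ω^ 𝟘) (y≤x+y 𝟘 (ω^ 𝟘)))) (ω^·<ω^ 0<x 1)

    Box-≔-⊆ : ∀ {p b} x → b ≤ ω^ α p → Box ((ω^_ ∘ α) [ p ≔ b ]) x → Box^ α x
    Box-≔-⊆ {p} {b} x b≤ x∈ i with i ≟ p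
    ... | yes refl = <-≤-trans (x p) b _ (Box-≔⁻-≡ {β = ω^_ ∘ α} {p = p} x∈) b≤
    ... | no i≢p   = Box-≔⁻-≢ {β = ω^_ ∘ α} {p = p} x∈ i i≢p

  AtLeast^-mono : (α : Vector (Ord ℓ) n) (γ δ : Ord ℓ) → γ ≤ δ → AtLeast^ α δ → AtLeast^ α γ
  AtLeast^-mono α γ δ γ≤δ = WidthAtLeast-mono id (ω^ γ) (ω^ δ) (ω^-mono-≤ γ δ γ≤δ)

  -- The summand 1 in both hypotheses keeps the head and the tail sum positive throughout the
  -- recursion, so whichever coordinate is lowered, a positive one remains on the other side.
  AtLeast^-𝟙+⊕ : (a b : Ord ℓ) (α : Vector (Ord ℓ) (suc n)) → 𝟙 + a ≤ head α → 𝟙 + b ≤ ⨁ (tail α) →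
                 AtLeast^ α (𝟙 + (a ⊕ b))
  AtLeast^-𝟙+⊕ {n = n} aa@(sup⁺ I f) bb@(sup⁺ J g) α a≤ b≤ =
    AtLeast^-step α (𝟙 + (aa ⊕ bb)) λ γ′ γ′< →
      reduce (λ i → AtLeast^-𝟙+⊕ (f i) bb) (λ j → AtLeast^-𝟙+⊕ aa (g j)) γ′ (<-+⁻ 𝟙 (aa ⊕ bb) γ′<)
    where
    0<α₀ : 𝟘 {ℓ} < head α
    0<α₀ = <-≤-trans 𝟘 (𝟙 + aa) (head α) (<-≤-trans 𝟘 (𝟙 {ℓ}) _ (≤⇒<sucᵒ (≤-refl 𝟘)) (≤-+ʳ 𝟙 aa)) a≤

    0<⨁ : 𝟘 {ℓ} < ⨁ (tail α)
    0<⨁ = <-≤-trans 𝟘 (𝟙 + bb) _ (<-≤-trans 𝟘 (𝟙 {ℓ}) _ (≤⇒<sucᵒ (≤-refl 𝟘)) (≤-+ʳ 𝟙 bb)) b≤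

    positive : ∃ λ q → 𝟘 {ℓ} < tail α q
    positive = let q , u , u<αq , _ = <⨁⁻ (tail α) 0<⨁ in q , ≤-<-trans 𝟘 u _ (𝟘≤ u) u<αq

    reduce : (∀ i (α : Vector (Ord ℓ) (suc n)) → 𝟙 + f i ≤ head α → 𝟙 + bb ≤ ⨁ (tail α) →
              AtLeast^ α (𝟙 + (f i ⊕ bb))) →
             (∀ j (α : Vector (Ord ℓ) (suc n)) → 𝟙 + aa ≤ head α → 𝟙 + g j ≤ ⨁ (tail α) →
              AtLeast^ α (𝟙 + (aa ⊕ g j))) →
             ∀ γ′ → γ′ < 𝟙 {ℓ} ⊎ (∃ λ z → z < aa ⊕ bb × γ′ ≤ 𝟙 + z) →
             ∃₂ λ p q → q ≢ p × 𝟘 {ℓ} < α q × ∃ λ a → a < α p × AtLeast^ (α [ p ≔ a ]) γ′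
    -- For exponent 0 a single point is enough, so the head may be lowered all the way to 0.
    reduce ihˡ ihʳ γ′ (inj₁ (_ , γ′≤0)) =
      let q , 0<αq = positive
      in zero , suc q , (λ ()) , 0<αq , 𝟘 , 0<α₀ ,
         AtLeast^-step (α [ zero ≔ 𝟘 ]) γ′ λ γ″ γ″<γ′ →
           contradiction (<-≤-trans γ″ γ′ (𝟘 {ℓ}) γ″<γ′ γ′≤0) ≮𝟘
    reduce ihˡ ihʳ γ′ (inj₂ (z , (inj₁ i , z≤) , γ′≤)) =
      let q , 0<αq = positive
          α′ = α [ zero ≔ 𝟙 + f i ]
      in zero , suc q , (λ ()) , 0<αq , 𝟙 + f i ,
         <-≤-trans (𝟙 + f i) (𝟙 + aa) (head α) (+-monoʳ-< 𝟙 (f i) aa (i , ≤-refl (f i))) a≤ ,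
         AtLeast^-mono α′ γ′ (𝟙 + (f i ⊕ bb))
           (≤-trans γ′ _ _ γ′≤ (+-mono-≤ _ _ _ _ (≤-refl 𝟙) z≤))
           (ihˡ i α′ (≤-refl (𝟙 + f i)) b≤)
    reduce ihˡ ihʳ γ′ (inj₂ (z , (inj₂ j , z≤) , γ′≤)) =
      let q , u , u<αq , gj≤ = <⨁⁻ (tail α) (<-≤-trans (𝟙 + g j) (𝟙 + bb) _
            (+-monoʳ-< 𝟙 (g j) bb (j , ≤-refl (g j))) b≤)
          α′ = α [ suc q ≔ u ]
      in suc q , zero , (λ ()) , 0<α₀ , u , u<αq ,
         AtLeast^-mono α′ γ′ (𝟙 + (aa ⊕ g j))
           (≤-trans γ′ _ _ γ′≤ (+-mono-≤ _ _ _ _ (≤-refl 𝟙) z≤))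
           (ihʳ j α′ a≤ gj≤)

-- The exponent

≈-trans : {x y z : Ord ℓ} → x ≈ y → y ≈ z → x ≈ z
≈-trans {x = x} {y} {z} (p , p′) (q , q′) = ≤-trans x y z p q , ≤-trans z y x q′ p′

≈-refl : {x : Ord ℓ} → x ≈ x
≈-refl {x = x} = ≤-refl x , ≤-refl x

+-𝟘 : (x : Ord ℓ) → x + 𝟘 ≈ x
+-𝟘 (sup⁺ I f) = (λ { (inj₁ i) → i , ≤-refl (f i) }) , λ i → inj₁ i , ≤-refl (f i)

+-sucᵒ : (x y : Ord ℓ) → x + sucᵒ y ≈ sucᵒ (x + y)
+-sucᵒ x@(sup⁺ I f) y =
  (λ { (inj₁ i) → tt , <⇒≤ (f i) (x + y) (<-≤-trans (f i) x _ (i , ≤-refl (f i)) (≤-+ʳ x y))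
     ; (inj₂ _) → tt , ≤-refl (x + y) }) ,
  λ _ → inj₂ tt , ≤-refl (x + y)

sucᵒ-cong : {x y : Ord ℓ} → x ≈ y → sucᵒ x ≈ sucᵒ y
sucᵒ-cong (p , q) = (λ _ → tt , p) , (λ _ → tt , q)

⊕-sucᵒ-≤ : (x y : Ord ℓ) → x ⊕ sucᵒ y ≤ sucᵒ (x ⊕ y)
⊕-sucᵒ-≤ x@(sup⁺ I f) y (inj₁ i) = tt , ≤-trans (f i ⊕ sucᵒ y) (sucᵒ (f i ⊕ y)) (x ⊕ y)
  (⊕-sucᵒ-≤ (f i) y) (<⇒sucᵒ≤ (⊕-monoˡ-< (f i) x y (i , ≤-refl (f i))))
⊕-sucᵒ-≤ x@(sup⁺ I f) y (inj₂ _) = tt , ≤-refl (x ⊕ y)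

⊕-fromℕ : (x : Ord ℓ) (k : ℕ) → x ⊕ fromℕ k ≈ x + fromℕ k
⊕-fromℕ x k = below k , +≤⊕ x (fromℕ k)
  where
  open ≤-Reasoning
  below : ∀ k → x ⊕ fromℕ k ≤ x + fromℕ k
  below zero    = ≤-trans (x ⊕ 𝟘) x _ (x⊕𝟘≤x x) (≤-+ʳ x 𝟘)
  below (suc k) = begin
    x ⊕ sucᵒ (fromℕ k)     ≤⟨ ⊕-sucᵒ-≤ x (fromℕ k) ⟩
    sucᵒ (x ⊕ fromℕ k)     ≤⟨ (λ _ → tt , below k) ⟩
    sucᵒ (x + fromℕ k)     ≤⟨ proj₂ (+-sucᵒ x (fromℕ k)) ⟩
    x + fromℕ (suc k)      ∎

fromℕ-+ : ∀ k l → fromℕ {ℓ} k + fromℕ l ≈ fromℕ {ℓ} (l ℕ.+ k)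
fromℕ-+ k zero    = +-𝟘 (fromℕ k)
fromℕ-+ k (suc l) = ≈-trans (+-sucᵒ (fromℕ k) (fromℕ l)) (sucᵒ-cong (fromℕ-+ k l))

fromℕ-⊕ : ∀ k l → fromℕ {ℓ} k ⊕ fromℕ l ≈ fromℕ {ℓ} (l ℕ.+ k)
fromℕ-⊕ k l = ≈-trans (⊕-fromℕ (fromℕ k) l) (fromℕ-+ k l)

𝟙+fromℕ : ∀ k → 𝟙 + fromℕ {ℓ} k ≈ fromℕ {ℓ} (suc k)
𝟙+fromℕ {ℓ} k = subst (λ l → 𝟙 + fromℕ {ℓ} k ≈ fromℕ {ℓ} l) (ℕ.+-comm k 1) (fromℕ-+ 1 k)

-- One `k` serves both sums, which allows `⨁` to be exchanged for `∑` in the explicit formulas.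
finite-sums : (α : Vector (Ord ℓ) n) → (∀ i → Finite (α i)) →
              ∃ λ k → ⨁ α ≈ fromℕ {ℓ} k × ∑ α ≈ fromℕ {ℓ} k
finite-sums {n = zero}  α fin = 0 , ≈-refl , ≈-refl
finite-sums {n = suc n} α fin =
  let k , α₀≈k = fin zero
      l , ⨁≈l , ∑≈l = finite-sums (tail α) (fin ∘ suc)
  in l ℕ.+ k , ≈-trans (⊕-cong α₀≈k ⨁≈l) (fromℕ-⊕ k l) , ≈-trans (+-cong α₀≈k ∑≈l) (fromℕ-+ k l)

positive-finite : {x : Ord ℓ} → 𝟘 {ℓ} < x → ∀ k → x ≈ fromℕ {ℓ} k → ∃ λ l → k ≡ suc l
positive-finite 0<x zero    (x≤0 , _) = contradiction (<-≤-trans 𝟘 _ 𝟘 0<x x≤0) ≮𝟘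
positive-finite 0<x (suc l) _         = l , refl

module _ (em : ExcludedMiddle ℓ) where

  ∸-unique : (β γ δ : Ord ℓ) → β + δ ≈ γ → γ ∸ β ≈ δ
  ∸-unique β γ δ β+δ≈γ = +-cancelˡ-≈ β (γ ∸ β) δ
    (≈-trans (+-∸ em β γ (≤-trans β (β + δ) γ (≤-+ʳ β δ) (proj₁ β+δ≈γ))) (≈-sym β+δ≈γ))

  ∸𝟙-fromℕ : (γ : Ord ℓ) (k : ℕ) → γ ≈ fromℕ {ℓ} (suc k) → γ ∸ 𝟙 ≈ fromℕ {ℓ} k
  ∸𝟙-fromℕ γ k γ≈ = ∸-unique 𝟙 γ (fromℕ k) (≈-trans (𝟙+fromℕ k) (≈-sym γ≈))

  ≤-finite : (x : Ord ℓ) (k : ℕ) → x ≤ fromℕ {ℓ} k → Finite x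
  ≤-finite x zero    x≤0 = 0 , x≤0 , 𝟘≤ x
  ≤-finite x (suc k) x≤k+1 with ≤-<-total em x (fromℕ k)
  ... | inj₁ x≤k = ≤-finite x k x≤k
  ... | inj₂ k<x = suc k , x≤k+1 , <⇒sucᵒ≤ k<x

  infinite-> : {x : Ord ℓ} → ¬ Finite x → ∀ k → fromℕ {ℓ} k < x
  infinite-> {x} inf k with ≤-<-total em x (fromℕ k)
  ... | inj₁ x≤k = contradiction (≤-finite x k x≤k) inf
  ... | inj₂ k<x = k<x

  -- A finite `g j` stays finite, hence below `x`, when 1 is added on the left; an infinite one
  -- absorbs the 1 by induction.
  𝟙+infinite : (x : Ord ℓ) → ¬ Finite x → 𝟙 + x ≤ x
  𝟙+infinite x@(sup⁺ J g) inf (inj₁ _) = infinite-> inf 0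
  𝟙+infinite x@(sup⁺ J g) inf (inj₂ j) with em {Finite (g j)}
  ... | yes (k , gj≈k) = ≤-<-trans (𝟙 + g j) (fromℕ (suc k)) x
        (proj₁ (≈-trans (+-cong ≈-refl gj≈k) (𝟙+fromℕ k))) (infinite-> inf (suc k))
  ... | no gj-inf = j , 𝟙+infinite (g j) gj-inf

  infinite-∸𝟙 : (x : Ord ℓ) → ¬ Finite x → x ∸ 𝟙 ≈ x
  infinite-∸𝟙 x inf = ∸-unique 𝟙 x x (𝟙+infinite x inf , y≤x+y 𝟙 x)

  𝟙+[x∸𝟙] : (x : Ord ℓ) → 𝟘 {ℓ} < x → 𝟙 + (x ∸ 𝟙) ≈ x
  𝟙+[x∸𝟙] x 0<x = +-∸ em 𝟙 x (<⇒sucᵒ≤ 0<x)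

  η : Vector (Ord ℓ) (suc n) → Ord ℓ
  η α = head α ⊕ (⨁ (tail α) ∸ 𝟙)

  -- If the tail sum is infinite, subtracting 1 does not change it and the full natural sum is the
  -- right bound; otherwise the refined recursion applies.
  AtMost^-η : (α : Vector (Ord ℓ) (suc n)) → 𝟘 {ℓ} < ⨁ (tail α) → AtMost^ α (η α)
  AtMost^-η α 0<⨁ with em {Finite (⨁ (tail α))}
  ... | no inf = AtMost^-⨁ em (η α) α
        (⊕-mono-≤ _ _ _ _ (≤-refl (head α)) (proj₂ (infinite-∸𝟙 (⨁ (tail α)) inf)))
  ... | yes (k , ⨁≈k) with positive-finite 0<⨁ k ⨁≈k
  ...   | s , refl = AtMost^-finite-tail em (η α) α s (proj₁ ⨁≈k)
        (⊕-mono-≤ _ _ _ _ (≤-refl (head α)) (proj₂ (∸𝟙-fromℕ (⨁ (tail α)) s ⨁≈k)))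

  -- Rests on a maximal head: with head 1 and tail sum ω, `η` would be ω + 1 but the bound from
  -- `AtLeast^-𝟙+⊕` only 1 + ω = ω.
  AtLeast^-η : (α : Vector (Ord ℓ) (suc n)) → (∀ i → α i ≤ head α) →
               𝟘 {ℓ} < head α → 𝟘 {ℓ} < ⨁ (tail α) → AtLeast^ α (η α)
  AtLeast^-η α α≤α₀ 0<α₀ 0<⨁ = AtLeast^-mono em α (η α) _ η≤
    (AtLeast^-𝟙+⊕ em (head α ∸ 𝟙) (T ∸ 𝟙) α
      (proj₁ (𝟙+[x∸𝟙] (head α) 0<α₀)) (proj₁ (𝟙+[x∸𝟙] T 0<⨁)))
    where
    open ≤-Reasoning
    T : Ord ℓ
    T = ⨁ (tail α)

    η≤ : η α ≤ 𝟙 + ((head α ∸ 𝟙) ⊕ (T ∸ 𝟙))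
    η≤ with em {Finite (head α)}
    ... | no inf = begin
      head α ⊕ (T ∸ 𝟙)
        ≤⟨ ⊕-mono-≤ _ _ _ _ (proj₂ (infinite-∸𝟙 (head α) inf)) (≤-refl (T ∸ 𝟙)) ⟩
      (head α ∸ 𝟙) ⊕ (T ∸ 𝟙)            ≤⟨ y≤x+y 𝟙 _ ⟩
      𝟙 + ((head α ∸ 𝟙) ⊕ (T ∸ 𝟙))      ∎
    -- A finite maximum makes all exponents finite, and the claim becomes an identity of natural
    -- numbers.
    ... | yes (k , α₀≈k)
      with l , T≈l , _ ← finite-sums (tail α) (λ i → ≤-finite _ k
             (≤-trans (α (suc i)) (head α) (fromℕ {ℓ} k) (α≤α₀ (suc i)) (proj₁ α₀≈k)))
      with k′ , refl ← positive-finite 0<α₀ k α₀≈k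
      with l′ , refl ← positive-finite 0<⨁ l T≈l = begin
      head α ⊕ (T ∸ 𝟙)                  ≈⟨ ⊕-cong α₀≈k (∸𝟙-fromℕ T l′ T≈l) ⟩
      fromℕ (suc k′) ⊕ fromℕ l′         ≈⟨ fromℕ-⊕ (suc k′) l′ ⟩
      fromℕ (l′ ℕ.+ suc k′)             ≡⟨ cong fromℕ (ℕ.+-suc l′ k′) ⟩
      fromℕ (suc (l′ ℕ.+ k′))           ≈⟨ ≈-sym (𝟙+fromℕ (l′ ℕ.+ k′)) ⟩
      𝟙 + fromℕ (l′ ℕ.+ k′)             ≈⟨ +-cong ≈-refl (≈-sym (fromℕ-⊕ k′ l′)) ⟩
      𝟙 + (fromℕ k′ ⊕ fromℕ l′)
        ≈⟨ +-cong ≈-refl (⊕-cong (≈-sym (∸𝟙-fromℕ (head α) k′ α₀≈k)) (≈-sym (∸𝟙-fromℕ T l′ T≈l))) ⟩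
      𝟙 + ((head α ∸ 𝟙) ⊕ (T ∸ 𝟙))      ∎

  η-finite : (α : Vector (Ord ℓ) (suc n)) → 𝟘 {ℓ} < ⨁ (tail α) → (∀ i → Finite (α i)) →
             η α ≈ ∑ α ∸ 𝟙
  η-finite α 0<⨁ fin
    with k , α₀≈k ← fin zero
    with l , ⨁≈l , ∑≈l ← finite-sums (tail α) (fin ∘ suc)
    with l′ , refl ← positive-finite 0<⨁ l ⨁≈l =
    ≈-trans (⊕-cong α₀≈k (∸𝟙-fromℕ _ l′ ⨁≈l)) (≈-trans (fromℕ-⊕ k l′)
      (≈-sym (∸𝟙-fromℕ (∑ α) (l′ ℕ.+ k) (≈-trans (+-cong α₀≈k ∑≈l) (fromℕ-+ k (suc l′))))))

  η-finite-tail : (α : Vector (Ord ℓ) (suc n)) → 𝟘 {ℓ} < ⨁ (tail α) → (∀ i → Finite (tail α i)) →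
                  η α ≈ head α + (∑ (tail α) ∸ 𝟙)
  η-finite-tail α 0<⨁ fin
    with l , ⨁≈l , ∑≈l ← finite-sums (tail α) fin
    with l′ , refl ← positive-finite 0<⨁ l ⨁≈l =
    ≈-trans (⊕-cong ≈-refl (∸𝟙-fromℕ _ l′ ⨁≈l)) (≈-trans (⊕-fromℕ (head α) l′)
      (+-cong ≈-refl (≈-sym (∸𝟙-fromℕ (∑ (tail α)) l′ ∑≈l))))

  η-infinite-tail : (α : Vector (Ord ℓ) (suc n)) (i : Fin n) → ¬ Finite (tail α i) → η α ≈ ⨁ α
  η-infinite-tail α i inf = ⊕-cong ≈-refl (infinite-∸𝟙 (⨁ (tail α)) λ (k , ⨁≈k) →
    inf (≤-finite (tail α i) k
      (≤-trans (tail α i) (⨁ (tail α)) (fromℕ {ℓ} k) (≤⨁ (tail α) i) (proj₁ ⨁≈k))))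

-- Transfer to the product of ordinals, and the theorem.

HasWidth-ω^ : (α : Vector (Ord ℓ) n) (γ : Ord ℓ) → AtMost^ α γ → AtLeast^ α γ →
              HasWidth (Π-preorder (λ i → ↓ (ω^ α i))) (ω^ γ)
HasWidth-ω^ {ℓ} {n} α γ w≤ w≥ =
  width-exact (ω^ γ) (WidthAtMost-reflect to-Box (ω^ γ) w≤)
    (WidthAtLeast-reflect from-Box (ω^ γ) w≥)
  where
  X : Preorder (lsuc ℓ) ℓ ℓ
  X = Π-preorder (λ i → ↓ (ω^ α i))

  to-Box : Reflection {A = X} {B = Ordⁿ ℓ n} (const ⊤) (Box^ α)
  to-Box = record
    { map      = λ x _ i → proj₁ (x i)
    ; maps-to  = λ x _ i → proj₂ (x i)
    ; reflects = λ _ _ _ _ x≤y → x≤y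
    }

  from-Box : Reflection {A = Ordⁿ ℓ n} {B = X} (Box^ α) (const ⊤)
  from-Box = record
    { map      = λ x x∈ i → x i , x∈ i
    ; maps-to  = λ _ _ → tt
    ; reflects = λ _ _ _ _ x≤y → x≤y
    }

mainTheorem8 : ∀ {ℓ : Level} → ExcludedMiddle (lsuc ℓ) →
    ∀ {m} (α : Vector (Ord ℓ) (suc (suc m))) →
    (∀ {i j} → i Fin.≤ j → α j ≤ α i) →
    𝟘 {ℓ} < α (Fin.fromℕ (suc m)) →
    let X = Π-preorder (λ i → ↓ (ω^ α i))
        η = head α ⊕ (⨁ (tail α) ∸ 𝟙)
    in  HasWidth X (ω^ η)
        × ((∀ i → Finite (α i)) → η ≈ ∑ α ∸ 𝟙)
        × (¬ Finite (head α) → (∀ i → Finite (tail α i)) → η ≈ head α + (∑ (tail α) ∸ 𝟙))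
        × (∀ i j → i ≢ j → ¬ Finite (α i) → ¬ Finite (α j) → η ≈ ⨁ α)
mainTheorem8 {ℓ} em′ {m} α decreasing 0<last =
  HasWidth-ω^ α (η em α) (AtMost^-η em α 0<⨁) (AtLeast^-η em α α≤α₀ 0<α₀ 0<⨁) ,
  η-finite em α 0<⨁ ,
  (λ _ → η-finite-tail em α 0<⨁) ,
  two-infinite
  where
  em : ExcludedMiddle ℓ
  em {P} = map′ lower lift (em′ {Lift (lsuc ℓ) P})

  α≤α₀ : ∀ i → α i ≤ head α
  α≤α₀ i = decreasing {zero} {i} z≤n

  0<α₀ : 𝟘 {ℓ} < head α
  0<α₀ = <-≤-trans 𝟘 _ (head α) 0<last (α≤α₀ (Fin.fromℕ (suc m)))

  0<⨁ : 𝟘 {ℓ} < ⨁ (tail α)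
  0<⨁ = <-≤-trans 𝟘 _ _ 0<last (≤⨁ (tail α) (Fin.fromℕ m))

  two-infinite : ∀ i j → i ≢ j → ¬ Finite (α i) → ¬ Finite (α j) → η em α ≈ ⨁ α
  -- Of two distinct indices at least one lies in the tail.
  two-infinite zero    zero    0≢0 _   _   = contradiction refl 0≢0
  two-infinite zero    (suc j) _   _   inf = η-infinite-tail em α j inf
  two-infinite (suc i) _       _   inf _   = η-infinite-tail em α i inf
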